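{- Let $M$ be a block matroid belonging to the class ${\mathrm{spex}}(\mathrm{LPM})$, with ground set $E$. Then there is a matroid $N$ on $E$ with $N\in{\mathrm{spex}}(\mathrm{LPM})$ whose set of bases is exactly the set of base-cobases of $M$; in particular $G(M,M^\ast)=G(N)$ (equality of graphs).
   Context: A matroid $M=(E,\mathcal{B})$ is given by its set of bases; its dual $M^\ast$ has bases $\{E\setminus B: B\in\mathcal{B}\}$. The base graph $G(M)$ has vertex set $\mathcal{B}$, with $B,B'$ adjacent iff $|B\triangle B'|=2$. $M$ is a block matroid if some base $B$ has $E\setminus B$ also a base; such $B$ is a base-cobase, and $G(M,M^\ast)$ is the subgraph of $G(M)$ induced by the base-cobases. Lattice path matroids (LPM): for nonnegative integers $m,r$, $n=m+r$, let $U,L$ be lattice paths from $(0,0)$ to $(m,r)$ with unit east and north steps, $L$ never above $U$. $M[U,L]$ is the matroid on $[n]$ whose bases are the sets $B\subseteq[n]$ such that the lattice path whose $i$-th step is north iff $i\in B$ stays weakly below $U$ and weakly above $L$. $\mathrm{LPM}$ is the class of all matroids isomorphic to some $M[U,L]$. A matroid $N'$ is a parallel extension of $M'$ if $N'$ has an element $e$ lying in a 2-element circuit of $N'$ with $N'\setminus e=M'$; it is a series extension of $M'$ if $N'$ has an element $e$ lying in a 2-element cocircuit of $N'$ with $N'/e=M'$. For a class $\mathbf{M}$ of matroids, ${\mathrm{spex}}(\mathbf{M})$ is the class of matroids obtained from members of $\mathbf{M}$ by finitely many series and parallel extensions (closure under isomorphism). -}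

module Defs where

open import Data.Nat using (ℕ; zero; suc; _≤_)
open import Data.Bool using (Bool; true; false)
open import Data.Fin using (Fin)
open import Data.Fin.Subset using (Subset; _∈_; _∉_; _⊆_; _⊂_; ∁; _∪_; _-_; ⁅_⁆; ∣_∣)
open import Data.Vec using (Vec; []; _∷_; tabulate; lookup; insertAt)
open import Data.Product using (Σ; ∃; ∃-syntax; _×_; _,_)
open import Relation.Binary.PropositionalEquality using (_≡_)
open import Relation.Nullary using (¬_)
open import Function.Bundles using (_⇔_)
open import Function.Definitions using (Bijective)
open import Level using (0ℓ)

BaseFamily : ℕ → Set₁
BaseFamily n = Subset n → Set

record IsMatroid {n : ℕ} (M : BaseFamily n) : Set where
  field
    base-exists : ∃[ B ] M B
    exchange    : ∀ B₁ B₂ → M B₁ → M B₂ → ∀ x → x ∈ B₁ → x ∉ B₂ →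
                  ∃[ y ] (y ∈ B₂ × y ∉ B₁ × M ((B₁ - x) ∪ ⁅ y ⁆))

dual : ∀ {n} → BaseFamily n → BaseFamily n
dual M B = M (∁ B)

Independent : ∀ {n} → BaseFamily n → Subset n → Set
Independent M I = ∃[ B ] (M B × I ⊆ B)

Circuit : ∀ {n} → BaseFamily n → Subset n → Set
Circuit M C = ¬ Independent M C × (∀ D → D ⊂ C → Independent M D)

Cocircuit : ∀ {n} → BaseFamily n → Subset n → Set
Cocircuit M C = Circuit (dual M) C

-- The ground set E ∖ {e} of a matroid on Fin (suc n) is identified with
-- Fin n via the order-preserving embedding (punchIn e): a subset of Fin n
-- becomes a subset of Fin (suc n) avoiding e.
embed : ∀ {n} → Fin (suc n) → Subset n → Subset (suc n)
embed e B = insertAt B e false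

delete : ∀ {n} → BaseFamily (suc n) → Fin (suc n) → BaseFamily n
delete N e B = Independent N (embed e B) ×
               (∀ I → Independent N (embed e I) → ∣ I ∣ ≤ ∣ B ∣)

contract : ∀ {n} → BaseFamily (suc n) → Fin (suc n) → BaseFamily n
contract N e = dual (delete (dual N) e)

_≈M_ : ∀ {n} → BaseFamily n → BaseFamily n → Set
M ≈M M' = ∀ B → M B ⇔ M' B

preimage : ∀ {a b} → (Fin a → Fin b) → Subset b → Subset a
preimage f S = tabulate (λ i → lookup S (f i))

_≅M_ : ∀ {n n'} → BaseFamily n → BaseFamily n' → Set
_≅M_ {n} {n'} M M' = Σ (Fin n → Fin n') λ f → Bijective _≡_ _≡_ f ×
                       (∀ B' → M' B' ⇔ M (preimage f B'))

-- Lattice path matroids.  A lattice path from (0,0) to (m,r), n = m + r,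
-- is encoded by the subset of [n] = Fin n of its north steps (size r).

prefixCount : ∀ {n} → ℕ → Subset n → ℕ
prefixCount zero    _            = 0
prefixCount (suc i) []           = 0
prefixCount (suc i) (true  ∷ v)  = suc (prefixCount i v)
prefixCount (suc i) (false ∷ v)  = prefixCount i v

WeaklyBelow : ∀ {n} → Subset n → Subset n → Set
WeaklyBelow P Q = ∀ i → prefixCount i P ≤ prefixCount i Q

LPMBases : ∀ {n} → ℕ → Subset n → Subset n → BaseFamily n
LPMBases r U L B = ∣ B ∣ ≡ r × WeaklyBelow B U × WeaklyBelow L B

IsLPM : ∀ {n} → BaseFamily n → Set
IsLPM {n} M = ∃[ r ] ∃[ U ] ∃[ L ]
  (∣ U ∣ ≡ r × ∣ L ∣ ≡ r × WeaklyBelow L U × M ≅M LPMBases {n} r U L)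

ParallelExt : ∀ {n} → BaseFamily (suc n) → BaseFamily n → Set
ParallelExt N' M' = ∃[ e ] ((∃[ C ] (Circuit N' C × ∣ C ∣ ≡ 2 × e ∈ C)) ×
                            delete N' e ≈M M')

SeriesExt : ∀ {n} → BaseFamily (suc n) → BaseFamily n → Set
SeriesExt N' M' = ∃[ e ] ((∃[ C ] (Cocircuit N' C × ∣ C ∣ ≡ 2 × e ∈ C)) ×
                          contract N' e ≈M M')

data Spex : ∀ {n} → BaseFamily n → Set₁ where
  lpm : ∀ {n} {M : BaseFamily n} → IsLPM M → Spex M
  par : ∀ {n} {M' : BaseFamily n} {N' : BaseFamily (suc n)} →
        Spex M' → ParallelExt N' M' → Spex N'
  ser : ∀ {n} {M' : BaseFamily n} {N' : BaseFamily (suc n)} →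
        Spex M' → SeriesExt N' M' → Spex N'
  iso : ∀ {n n'} {M : BaseFamily n} {M' : BaseFamily n'} →
        Spex M → M ≅M M' → Spex M'

BaseCobase : ∀ {n} → BaseFamily n → Subset n → Set
BaseCobase M B = M B × M (∁ B)

IsBlock : ∀ {n} → BaseFamily n → Set
IsBlock M = ∃[ B ] BaseCobase M B

{-# OPTIONS --safe #-}
-- For a lattice path matroid, B is a base-cobase iff the path of B and the path of its complement
-- both stay between L and U; this again confines every prefix count of B to an interval, and such
-- families of paths are lattice path matroids because paths are closed under pointwise maximum and
-- minimum.  If e and f are parallel, a base-cobase contains exactly one of them, and what remains
-- is a base-cobase of the contraction of f in the matroid with e deleted.  So, for N₀ the matroid
-- of these remainders, the base-cobases are the bases of N₀ plus a coloop f plus an element e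
-- parallel to f, and one concludes by induction on the size of the ground set, since spex(LPM) is
-- closed under minors and under adding coloops.  Series pairs are handled by duality.

module Submission where

open import Defs
open import Data.Bool using (Bool; true; false; not)
open import Data.Bool.Properties using (not-injective; not-involutive; ¬-not; ∨-identityʳ; ∨-zeroʳ)
open import Data.Empty using (⊥; ⊥-elim)
open import Data.Fin using (Fin; zero; suc; _≟_; toℕ; punchIn; punchOut)
open import Data.Fin.Permutation
  using (Permutation; Permutation′; _⟨$⟩ʳ_; _⟨$⟩ˡ_; inverseˡ; inverseʳ; flip; remove; lift₀;
    insert; insert-punchIn; punchIn-permute′; ↔⇒≡)
  renaming (id to idₚ)
open import Data.Fin.Properties
  using (toℕ≤pred[n]; punchIn-punchOut)
  renaming (suc-injective to Fin-suc-injective)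
open import Data.Fin.Subset using (Subset; _∈_; _∉_; ∁; _∪_; _-_; ⁅_⁆; ∣_∣; _⊂_) renaming (⊥ to ∅)
open import Data.Fin.Subset.Properties
  using (drop-there; p⊆q⇒∣p∣≤∣q∣; p─⊥≡p; ∪-identityʳ; ∣∁p∣≡n∸∣p∣; anySubset?; p⊂q⇒∣p∣<∣q∣; ∣⊥∣≡0; ∉⊥; x∈⁅x⁆;
    x∈⁅y⁆⇒x≡y)
open import Data.List using (List; []; _∷_; filter; allFin)
open import Data.List.Membership.Propositional using () renaming (_∈_ to _∈ˡ_; _∉_ to _∉ˡ_)
open import Data.List.Membership.Propositional.Properties using (∈-allFin; ∈-filter⁺; ∈-filter⁻)
open import Data.List.Relation.Unary.Any using (here; there)
open import Data.Nat using (ℕ; zero; suc; _≤_; _<_; z≤n; s≤s; _+_; _∸_; _⊔_; _⊓_; _≤?_; _<?_; _<ᵇ_)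
open import Data.Nat.Properties
  using (≤-reflexive; ≤-trans; suc-injective; ≤-refl; ≤-antisym; ≤-total; <⇒≤; ≰⇒>; ≮⇒≥; n≤1+n;
    m≤n⇒m<n∨m≡n; +-suc; +-identityʳ; +-∸-assoc; ∸-monoʳ-≤; ⊔-sel; ⊓-sel; ⊔-mono-≤; ⊓-mono-≤;
    m≤m⊔n; m≤n⊔m; m⊓n≤m; m⊓n≤n; allUpTo?; 1+n≰n; m≤n⇒m≤1+n; <⇒≱)
open import Data.Product using (Σ; ∃; ∃-syntax; _×_; _,_; proj₁; proj₂)
open import Data.Sum as Sum using (_⊎_; inj₁; inj₂)
open import Data.Unit using (⊤; tt)
open import Data.Vec using (Vec; []; _∷_; lookup; _[_]≔_; insertAt; removeAt; here; there)
open import Data.Vec.Properties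
  using ([]=⇒lookup; lookup⇒[]=; lookup-map; lookup∘update; lookup∘update′; tabulate∘lookup;
    lookup∘tabulate; insertAt-lookup; insertAt-punchIn; map-insertAt; insertAt-removeAt)
open import Function using (_∘_; case_of_; id)
open import Function.Bundles using (_⇔_; mk⇔; Equivalence; mk⤖; Bijection)
open import Function.Construct.Composition using (_⇔-∘_)
open import Function.Construct.Identity using (⇔-id)
open import Function.Construct.Symmetry using (⇔-sym)
open import Function.Definitions using (Bijective)
open import Function.Properties.Bijection using (⤖⇒↔)
open import Function.Properties.Inverse using (↔⇒⤖)
open import Relation.Binary.PropositionalEquality
  using (_≡_; _≢_; refl; sym; trans; cong; cong₂; subst)
open import Relation.Nullary using (¬_; yes; no; contradiction; ¬?; Dec)
open import Relation.Nullary.Decidable using (_×-dec_; _→-dec_) renaming (map to map-dec)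

open Equivalence using (to; from)

-- Two changes of description carry the proof. A lattice path matroid becomes a family given by a
-- convex set of admissible counts at each position: intersection, duality, minors and coloops act
-- directly on these sets, and bounding paths are recovered only when `Spex` is re-entered. The
-- class spex(LPM) becomes `Sp`, in which duality is a constructor; since a matroid and its dual
-- have the same base-cobases, that case of the induction is immediate.
--
-- A derivation of `Spex` consists of bare families, and only the last one is known to be a matroid.
-- Base exchange therefore travels down the derivation, where it is what turns `delete`, defined by
-- largest independent sets, into a plain restriction of the bases.

private variable
  n : ℕ

-- Subsets as Boolean vectors, and replacing one element by another

lookup-ext : ∀ {A : Set} {xs ys : Vec A n} → (∀ i → lookup xs i ≡ lookup ys i) → xs ≡ ys
lookup-ext {xs = []}     {[]}     _ = refl
lookup-ext {xs = x ∷ xs} {y ∷ ys} h = cong₂ _∷_ (h zero) (lookup-ext (h ∘ suc))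

true≢false : {b : Bool} → b ≡ true → b ≡ false → ⊥
true≢false refl ()

-- Membership and non-membership are both equations on a Boolean, so that a `with` on `lookup`
-- decides between them and complementation swaps them.
_∋_ : Subset n → Fin n → Set
B ∋ x = lookup B x ≡ true

_∌_ : Subset n → Fin n → Set
B ∌ x = lookup B x ≡ false

infix 4 _∋_ _∌_

∌⇒∉ : {B : Subset n} {x : Fin n} → B ∌ x → x ∉ B
∌⇒∉ B∌x x∈B = true≢false ([]=⇒lookup x∈B) B∌x

∉⇒∌ : {B : Subset n} {x : Fin n} → x ∉ B → B ∌ x
∉⇒∌ x∉B = ¬-not (λ B∋x → x∉B (lookup⇒[]= _ _ B∋x))

∋-≢ : (B : Subset n) {x y : Fin n} → B ∋ x → B ∌ y → x ≢ y
∋-≢ B B∋x B∌y refl = true≢false B∋x B∌y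

infixl 6 _⟨_↦_⟩

_⟨_↦_⟩ : Subset n → Fin n → Fin n → Subset n
B ⟨ x ↦ y ⟩ = B [ x ]≔ false [ y ]≔ true

↦-∋ : ∀ (B : Subset n) {x y z} → B ∋ z → z ≢ x → B ⟨ x ↦ y ⟩ ∋ z
↦-∋ B {x} {y} {z} B∋z z≢x with z ≟ y
... | yes refl = lookup∘update z (B [ x ]≔ false) true
... | no z≢y = trans (lookup∘update′ z≢y (B [ x ]≔ false) true)
                 (trans (lookup∘update′ z≢x B false) B∋z)

↦-∋⁻ : ∀ (B : Subset n) {x y z} → B ⟨ x ↦ y ⟩ ∋ z → z ≡ y ⊎ (z ≢ x × B ∋ z)
↦-∋⁻ B {x} {y} {z} h with z ≟ y
... | yes z≡y = inj₁ z≡y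
... | no z≢y with trans (sym (lookup∘update′ z≢y (B [ x ]≔ false) true)) h
...   | h′ with z ≟ x
...     | yes refl = ⊥-elim (true≢false h′ (lookup∘update z B false))
...     | no z≢x = inj₂ (z≢x , trans (sym (lookup∘update′ z≢x B false)) h′)

∣≔true∣ : (B : Subset n) (y : Fin n) → B ∌ y → ∣ B [ y ]≔ true ∣ ≡ suc ∣ B ∣
∣≔true∣ (false ∷ B) zero    _ = refl
∣≔true∣ (true  ∷ B) (suc y) h = cong suc (∣≔true∣ B y h)
∣≔true∣ (false ∷ B) (suc y) h = ∣≔true∣ B y h

∣≔false∣ : (B : Subset n) (x : Fin n) → B ∋ x → suc ∣ B [ x ]≔ false ∣ ≡ ∣ B ∣
∣≔false∣ (true  ∷ B) zero    _ = refl
∣≔false∣ (true  ∷ B) (suc x) h = cong suc (∣≔false∣ B x h)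
∣≔false∣ (false ∷ B) (suc x) h = ∣≔false∣ B x h

∣↦∣ : ∀ (B : Subset n) {x y} → B ∋ x → B ∌ y → ∣ B ⟨ x ↦ y ⟩ ∣ ≡ ∣ B ∣
∣↦∣ B {x} {y} B∋x B∌y = trans
  (∣≔true∣ (B [ x ]≔ false) y (trans (lookup∘update′ (∋-≢ B B∋x B∌y ∘ sym) B false) B∌y))
  (∣≔false∣ B x B∋x)

↦-involutive : ∀ (B : Subset n) {x y} → B ∋ x → B ∌ y → B ⟨ x ↦ y ⟩ ⟨ y ↦ x ⟩ ≡ B
↦-involutive B {x} {y} B∋x B∌y = lookup-ext λ z → pointwise z
  where
  pointwise : ∀ z → lookup (B ⟨ x ↦ y ⟩ ⟨ y ↦ x ⟩) z ≡ lookup B z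
  pointwise z with z ≟ x
  ... | yes refl = trans (lookup∘update z (B ⟨ z ↦ y ⟩ [ y ]≔ false) true) (sym B∋x)
  ... | no z≢x with z ≟ y
  ...   | yes refl = trans (lookup∘update′ z≢x (B ⟨ x ↦ z ⟩ [ z ]≔ false) true)
                       (trans (lookup∘update z (B ⟨ x ↦ z ⟩) false) (sym B∌y))
  ...   | no z≢y = trans (lookup∘update′ z≢x (B ⟨ x ↦ y ⟩ [ y ]≔ false) true)
                     (trans (lookup∘update′ z≢y (B ⟨ x ↦ y ⟩) false)
                     (trans (lookup∘update′ z≢y (B [ x ]≔ false) true)
                       (lookup∘update′ z≢x B false)))

∁-↦ : ∀ (B : Subset n) {x y} → x ≢ y → ∁ (B ⟨ x ↦ y ⟩) ≡ ∁ B ⟨ y ↦ x ⟩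
∁-↦ B {x} {y} x≢y = lookup-ext λ z → trans (lookup-map z not (B ⟨ x ↦ y ⟩)) (pointwise z)
  where
  pointwise : ∀ z → not (lookup (B ⟨ x ↦ y ⟩) z) ≡ lookup (∁ B ⟨ y ↦ x ⟩) z
  pointwise z with z ≟ x
  ... | yes refl = trans (cong not (trans (lookup∘update′ x≢y (B [ z ]≔ false) true)
                                          (lookup∘update z B false)))
                     (sym (lookup∘update z (∁ B [ y ]≔ false) true))
  ... | no z≢x with z ≟ y
  ...   | yes refl = trans (cong not (lookup∘update z (B [ x ]≔ false) true))
                       (sym (trans (lookup∘update′ z≢x (∁ B [ z ]≔ false) true)
                                   (lookup∘update z (∁ B) false)))
  ...   | no z≢y = trans (cong not (trans (lookup∘update′ z≢y (B [ x ]≔ false) true)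
                                          (lookup∘update′ z≢x B false)))
                     (sym (trans (lookup∘update′ z≢x (∁ B [ y ]≔ false) true)
                          (trans (lookup∘update′ z≢y (∁ B) false) (lookup-map z not B))))

∁-involutive : (B : Subset n) → ∁ (∁ B) ≡ B
∁-involutive []      = refl
∁-involutive (b ∷ B) = cong₂ _∷_ (not-involutive b) (∁-involutive B)

∁-∋ : ∀ (B : Subset n) {x} → B ∌ x → ∁ B ∋ x
∁-∋ B {x} h = trans (lookup-map x not B) (cong not h)

∁-∌ : ∀ (B : Subset n) {x} → B ∋ x → ∁ B ∌ x
∁-∌ B {x} h = trans (lookup-map x not B) (cong not h)

∁-∋⁻ : ∀ (B : Subset n) {x} → ∁ B ∋ x → B ∌ x
∁-∋⁻ B {x} h = not-injective (trans (sym (lookup-map x not B)) h)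

∁-∌⁻ : ∀ (B : Subset n) {x} → ∁ B ∌ x → B ∋ x
∁-∌⁻ B {x} h = not-injective (trans (sym (lookup-map x not B)) h)

-- Matroids by base exchange

Exchange : BaseFamily n → Set
Exchange M = ∀ {A B} → M A → M B → ∀ {x} → A ∋ x → B ∌ x →
             ∃[ y ] (B ∋ y × A ∌ y × M (A ⟨ x ↦ y ⟩))

minus-update : (B : Subset n) (x : Fin n) → B - x ≡ B [ x ]≔ false
minus-update (b ∷ B) zero    = cong (false ∷_) (p─⊥≡p B)
minus-update (b ∷ B) (suc x) = cong (b ∷_) (minus-update B x)

∪-update : (B : Subset n) (y : Fin n) → B ∪ ⁅ y ⁆ ≡ B [ y ]≔ true
∪-update (b ∷ B) zero    = cong₂ _∷_ (∨-zeroʳ b) (∪-identityʳ B)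
∪-update (b ∷ B) (suc y) = cong₂ _∷_ (∨-identityʳ b) (∪-update B y)

exchange-set : (B : Subset n) (x y : Fin n) → (B - x) ∪ ⁅ y ⁆ ≡ B ⟨ x ↦ y ⟩
exchange-set B x y = trans (∪-update (B - x) y) (cong (_[ y ]≔ true) (minus-update B x))

IsMatroid⇒Exchange : {M : BaseFamily n} → IsMatroid M → Exchange M
IsMatroid⇒Exchange {M = M} isM {A} {B} MA MB {x} A∋x B∌x =
  case IsMatroid.exchange isM A B MA MB x (lookup⇒[]= x A A∋x) (∌⇒∉ B∌x) of λ where
    (y , y∈B , y∉A , MA′) →
      y , []=⇒lookup y∈B , ∉⇒∌ y∉A , subst M (exchange-set A x y) MA′

Exchange⇒IsMatroid : {M : BaseFamily n} → ∃ M → Exchange M → IsMatroid M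
Exchange⇒IsMatroid {M = M} inh ex = record
  { base-exists = inh
  ; exchange = λ A B MA MB x x∈A x∉B →
      case ex MA MB ([]=⇒lookup x∈A) (∉⇒∌ x∉B) of λ where
        (y , B∋y , A∌y , MA′) →
          y , lookup⇒[]= y B B∋y , ∌⇒∉ A∌y , subst M (sym (exchange-set A x y)) MA′
  }

module _ {M : BaseFamily n} (ex : Exchange M) where

  -- An element of `B` outside `A` would have to be exchanged for an element of `A` outside `B`, and
  -- there is none.
  ⊆-base⇒≡ : ∀ {A B} → M A → M B → (∀ {z} → A ∋ z → B ∋ z) → A ≡ B
  ⊆-base⇒≡ {A} {B} MA MB A⊆B = lookup-ext pointwise
    where
    pointwise : ∀ z → lookup A z ≡ lookup B z
    pointwise z with lookup A z in eqA | lookup B z in eqB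
    ... | true  | true  = refl
    ... | false | false = refl
    ... | true  | false = sym (trans (sym eqB) (A⊆B eqA))
    ... | false | true  with ex MB MA eqB eqA
    ...   | y , A∋y , B∌y , _ = ⊥-elim (true≢false (A⊆B A∋y) B∌y)

  -- A base obtained from B by exchanging the elements of l outside A for elements of A.
  record Swept (A B : Subset n) (l : List (Fin n)) : Set where
    field
      base    : Subset n
      isBase  : M base
      card    : ∣ base ∣ ≡ ∣ B ∣
      keeps-∩ : ∀ {z} → B ∋ z → A ∋ z → base ∋ z
      swept   : ∀ {z} → z ∈ˡ l → base ∋ z → A ∋ z
      keeps   : ∀ {z} → z ∉ˡ l → B ∋ z → base ∋ z

  -- Every exchange is made against `A` and so brings in only elements of `A`; what has been swept
  -- out never returns.
  sweep : ∀ {A B} → M A → M B → ∀ l → Swept A B l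
  sweep {B = B} MA MB [] = record
    { base = B ; isBase = MB ; card = refl ; keeps-∩ = λ h _ → h ; swept = λ () ; keeps = λ _ h → h }
  sweep {A} MA MB (x ∷ l) = extend (sweep MA MB l)
    where
    unchanged : ∀ {B} (s : Swept A B l) → (Swept.base s ∋ x → A ∋ x) → Swept A B (x ∷ l)
    unchanged s h = record
      { Swept s
      ; swept = λ { (here refl) → h ; (there z∈l) → Swept.swept s z∈l }
      ; keeps = λ z∉ → Swept.keeps s (z∉ ∘ there)
      }

    extend : ∀ {B} → Swept A B l → Swept A B (x ∷ l)
    extend s with lookup (Swept.base s) x in eqC | lookup A x in eqA
    ... | false | _    = unchanged s (λ h → ⊥-elim (true≢false h eqC))
    ... | true  | true = unchanged s (λ _ → eqA)
    ... | true  | false with ex (Swept.isBase s) MA eqC eqA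
    ...   | y , A∋y , C∌y , MC′ = record
      { base    = C ⟨ x ↦ y ⟩
      ; isBase  = MC′
      ; card    = trans (∣↦∣ C eqC C∌y) card
      ; keeps-∩ = λ B∋z A∋z → ↦-∋ C (keeps-∩ B∋z A∋z) (∋-≢ A A∋z eqA)
      ; swept   = λ z∈ h → case ↦-∋⁻ C h of λ where
          (inj₁ refl) → A∋y
          (inj₂ (z≢x , C∋z)) → case z∈ of λ where
            (here z≡x) → contradiction z≡x z≢x
            (there z∈l) → swept z∈l C∋z
      ; keeps   = λ z∉ B∋z → ↦-∋ C (keeps (z∉ ∘ there) B∋z) (z∉ ∘ here)
      }
      where open Swept s renaming (base to C)

  -- Sweeping all elements puts a base of the size of `B` inside `A`.
  ∣bases∣-≤ : ∀ {A B} → M A → M B → ∣ B ∣ ≤ ∣ A ∣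
  ∣bases∣-≤ {A} MA MB = ≤-trans (≤-reflexive (sym card))
      (p⊆q⇒∣p∣≤∣q∣ {p = base} {q = A} λ z∈ → lookup⇒[]= _ A (swept (∈-allFin _) ([]=⇒lookup z∈)))
    where open Swept (sweep MA MB (allFin n))

  -- Sweeping all of B except x into A leaves a base inside A + x, which has to be A − y + x.
  coexchange : ∀ {A B} → M A → M B → ∀ {x} → A ∌ x → B ∋ x →
               ∃[ y ] (A ∋ y × B ∌ y × M (A ⟨ y ↦ x ⟩))
  coexchange {A} {B} MA MB {x} A∌x B∋x
    with sweep MA MB (filter (λ z → ¬? (z ≟ x)) (allFin n))
  ... | record { base = C ; isBase = MC ; keeps-∩ = keeps-∩ ; swept = swept ; keeps = keeps }
    with keeps (λ x∈ → proj₂ (∈-filter⁻ (λ z → ¬? (z ≟ x)) {xs = allFin n} x∈) refl) B∋x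
  ...   | C∋x with ex MC MA C∋x A∌x
  ...     | y , A∋y , C∌y , MC′ =
      y , A∋y , ¬-not (λ B∋y → true≢false (keeps-∩ B∋y A∋y) C∌y) ,
      subst M (trans (sym (↦-involutive C C∋x C∌y)) (cong _⟨ y ↦ x ⟩ C′≡A)) MC
    where
    C′≡A : C ⟨ x ↦ y ⟩ ≡ A
    C′≡A = ⊆-base⇒≡ MC′ MA λ {z} h → case ↦-∋⁻ C h of λ where
      (inj₁ refl) → A∋y
      (inj₂ (z≢x , C∋z)) → swept (∈-filter⁺ (λ z → ¬? (z ≟ x)) (∈-allFin z) z≢x) C∋z

  -- Taking `x` out of a cobase adds it to the complementary base, so this is `coexchange` read on
  -- complements.
  dual-Exchange : Exchange (dual M)
  dual-Exchange {A} {B} MA MB A∋x B∌x with coexchange MA MB (∁-∌ A A∋x) (∁-∋ B B∌x)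
  ... | y , A∌y , B∋y , MA′ =
    y , ∁-∌⁻ B B∋y , ∁-∋⁻ A A∌y , subst M (sym (∁-↦ A (∋-≢ A A∋x (∁-∋⁻ A A∌y)))) MA′

-- Counting north steps in prefixes

step : Bool → ℕ → ℕ
step true  c = suc c
step false c = c

step-comm : ∀ a b c → step a (step b c) ≡ step b (step a c)
step-comm true  true  c = refl
step-comm true  false c = refl
step-comm false true  c = refl
step-comm false false c = refl

step-injective : ∀ b {c d} → step b c ≡ step b d → c ≡ d
step-injective true  = suc-injective
step-injective false = id

step-mono : ∀ b {c d} → c ≤ d → step b c ≤ step b d
step-mono true  = s≤s
step-mono false = id

prefixCount-∷ : ∀ i b (B : Subset n) → prefixCount (suc i) (b ∷ B) ≡ step b (prefixCount i B)
prefixCount-∷ i true  B = refl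
prefixCount-∷ i false B = refl

-- `WeaklyBelow` quantifies over all `i`, interval families only over `i ≤ n`; this bridges the two.
prefixCount-⊓ : ∀ i (B : Subset n) → prefixCount i B ≡ prefixCount (i ⊓ n) B
prefixCount-⊓ zero    B           = refl
prefixCount-⊓ (suc i) []          = refl
prefixCount-⊓ (suc i) (true  ∷ B) = cong suc (prefixCount-⊓ i B)
prefixCount-⊓ (suc i) (false ∷ B) = prefixCount-⊓ i B

prefixCount-full : (B : Subset n) → prefixCount n B ≡ ∣ B ∣
prefixCount-full []          = refl
prefixCount-full (true  ∷ B) = cong suc (prefixCount-full B)
prefixCount-full (false ∷ B) = prefixCount-full B

prefixCount-suc-≥ : ∀ i (B : Subset n) → prefixCount i B ≤ prefixCount (suc i) B
prefixCount-suc-≥ zero    B           = z≤n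
prefixCount-suc-≥ (suc i) []          = z≤n
prefixCount-suc-≥ (suc i) (true  ∷ B) = s≤s (prefixCount-suc-≥ i B)
prefixCount-suc-≥ (suc i) (false ∷ B) = prefixCount-suc-≥ i B

prefixCount-suc-≤ : ∀ i (B : Subset n) → prefixCount (suc i) B ≤ suc (prefixCount i B)
prefixCount-suc-≤ i       []          = z≤n
prefixCount-suc-≤ zero    (true  ∷ B) = ≤-refl
prefixCount-suc-≤ zero    (false ∷ B) = z≤n
prefixCount-suc-≤ (suc i) (true  ∷ B) = s≤s (prefixCount-suc-≤ i B)
prefixCount-suc-≤ (suc i) (false ∷ B) = prefixCount-suc-≤ i B

prefixCount-≤ : ∀ i (B : Subset n) → prefixCount i B ≤ i
prefixCount-≤ zero    B           = z≤n
prefixCount-≤ (suc i) []          = z≤n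
prefixCount-≤ (suc i) (true  ∷ B) = s≤s (prefixCount-≤ i B)
prefixCount-≤ (suc i) (false ∷ B) = ≤-trans (prefixCount-≤ i B) (n≤1+n i)

prefixCount-∁ : ∀ {i} (B : Subset n) → i ≤ n → prefixCount i (∁ B) ≡ i ∸ prefixCount i B
prefixCount-∁ B           z≤n       = refl
prefixCount-∁ (true  ∷ B) (s≤s i≤n) = prefixCount-∁ B i≤n
prefixCount-∁ {i = suc i} (false ∷ B) (s≤s i≤n) =
  trans (cong suc (prefixCount-∁ B i≤n)) (sym (+-∸-assoc 1 (prefixCount-≤ i B)))

prefixCount-insertAt-≤ : ∀ {i} (B : Subset n) g b → i ≤ toℕ g →
                         prefixCount i (insertAt B g b) ≡ prefixCount i B
prefixCount-insertAt-≤ {i = zero}  B           g       b _         = refl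
prefixCount-insertAt-≤ {i = suc i} B           zero    b ()
prefixCount-insertAt-≤ {i = suc i} (true  ∷ B) (suc g) b (s≤s i≤g) =
  cong suc (prefixCount-insertAt-≤ B g b i≤g)
prefixCount-insertAt-≤ {i = suc i} (false ∷ B) (suc g) b (s≤s i≤g) =
  prefixCount-insertAt-≤ B g b i≤g

prefixCount-insertAt-≥ : ∀ {i} (B : Subset n) g b → toℕ g ≤ i →
                         prefixCount (suc i) (insertAt B g b) ≡ step b (prefixCount i B)
prefixCount-insertAt-≥ {i = i} B zero b _ = prefixCount-∷ i b B
prefixCount-insertAt-≥ {i = suc i} (a ∷ B) (suc g) b (s≤s g≤i) =
  trans (prefixCount-∷ (suc i) a (insertAt B g b))
  (trans (cong (step a) (prefixCount-insertAt-≥ B g b g≤i))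
  (trans (step-comm a b _) (cong (step b) (sym (prefixCount-∷ i a B)))))

∣insertAt∣ : ∀ (B : Subset n) g b → ∣ insertAt B g b ∣ ≡ step b ∣ B ∣
∣insertAt∣ B           zero    true  = refl
∣insertAt∣ B           zero    false = refl
∣insertAt∣ (true  ∷ B) (suc g) b = trans (cong suc (∣insertAt∣ B g b)) (step-comm true b _)
∣insertAt∣ (false ∷ B) (suc g) b = ∣insertAt∣ B g b

-- Interval families

-- R i c says that c is admissible as the number of north steps among the first i.
record Interval (M : BaseFamily n) : Set₁ where
  field
    R      : ℕ → ℕ → Set
    R?     : ∀ i c → Dec (R i c)
    convex : ∀ i {a b c} → a ≤ b → b ≤ c → R i a → R i c → R i b
    card   : ∀ {A B} → M A → M B → ∣ A ∣ ≡ ∣ B ∣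
    char   : ∀ B → M B ⇔ (∀ i → i ≤ n → R i (prefixCount i B))

  decidable : ∀ B → Dec (M B)
  decidable B = map-dec
    (mk⇔ (λ h → from (char B) (λ _ i≤n → h (s≤s i≤n))) (λ { MB (s≤s i≤n) → to (char B) MB _ i≤n }))
    (allUpTo? (λ i → R? i (prefixCount i B)) (suc n))

Interval-LPM : ∀ {r} {U L : Subset n} → ∣ U ∣ ≡ r → ∣ L ∣ ≡ r → Interval (LPMBases r U L)
Interval-LPM {n} {r} {U} {L} ∣U∣ ∣L∣ = record
  { R      = λ i c → prefixCount i L ≤ c × c ≤ prefixCount i U
  ; R?     = λ i c → (prefixCount i L ≤? c) ×-dec (c ≤? prefixCount i U)
  ; convex = λ i a≤b b≤c (L≤a , _) (_ , c≤U) → ≤-trans L≤a a≤b , ≤-trans b≤c c≤U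
  ; card   = λ (∣A∣ , _) (∣B∣ , _) → trans ∣A∣ (sym ∣B∣)
  ; char   = λ B → mk⇔ (λ (_ , B≤U , L≤B) i _ → L≤B i , B≤U i) 
      (λ h → size B h , above B h , below B h)
  }
  where
  Bounds : Subset n → Set
  Bounds B = ∀ i → i ≤ n → prefixCount i L ≤ prefixCount i B × prefixCount i B ≤ prefixCount i U
  size : ∀ B → Bounds B → ∣ B ∣ ≡ r
  -- At position `n` both bounding paths have count `r`, which forces the size of `B`.
  size B h with h n ≤-refl
  ... | L≤B , B≤U rewrite prefixCount-full B | prefixCount-full U | prefixCount-full L | ∣U∣ | ∣L∣ =
    ≤-antisym B≤U L≤B
  above : ∀ B → Bounds B → WeaklyBelow B U
  above B h i rewrite prefixCount-⊓ i B | prefixCount-⊓ i U = proj₂ (h (i ⊓ n) (m⊓n≤n i n))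
  below : ∀ B → Bounds B → WeaklyBelow L B
  below B h i rewrite prefixCount-⊓ i B | prefixCount-⊓ i L = proj₁ (h (i ⊓ n) (m⊓n≤n i n))

-- The truncated subtraction is harmless: prefix counts never exceed `i`, and convexity only uses
-- that `i ∸_` is antitone.
Interval-dual : {M : BaseFamily n} → Interval M → Interval (dual M)
Interval-dual {n} {M} I = record
  { R      = λ i c → R i (i ∸ c)
  ; R?     = λ i c → R? i (i ∸ c)
  ; convex = λ i a≤b b≤c Ra Rc → convex i (∸-monoʳ-≤ i b≤c) (∸-monoʳ-≤ i a≤b) Rc Ra
  ; card   = λ {A} {B} MA MB → trans (size A) (trans (cong (n ∸_) (card MA MB)) (sym (size B)))
  ; char   = λ B → mk⇔
      (λ MB i i≤n → subst (R i) (prefixCount-∁ B i≤n) (to (char (∁ B)) MB i i≤n))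
      (λ h → from (char (∁ B)) (λ i i≤n → subst (R i) (sym (prefixCount-∁ B i≤n)) (h i i≤n)))
  }
  where
  open Interval I
  size : ∀ A → ∣ A ∣ ≡ n ∸ ∣ ∁ A ∣
  size A = trans (cong ∣_∣ (sym (∁-involutive A))) (∣∁p∣≡n∸∣p∣ (∁ A))

Interval-∩ : {M N : BaseFamily n} → Interval M → Interval N → Interval (λ B → M B × N B)
Interval-∩ I J = record
  { R      = λ i c → I.R i c × J.R i c
  ; R?     = λ i c → I.R? i c ×-dec J.R? i c
  ; convex = λ i a≤b b≤c (Ia , Ja) (Ic , Jc) → I.convex i a≤b b≤c Ia Ic , J.convex i a≤b b≤c Ja Jc
  ; card   = λ (MA , _) (MB , _) → I.card MA MB
  ; char   = λ B → mk⇔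
      (λ (MB , NB) i i≤n → to (I.char B) MB i i≤n , to (J.char B) NB i i≤n)
      (λ h → from (I.char B) (λ i → proj₁ ∘ h i) , from (J.char B) (λ i → proj₂ ∘ h i))
  }
  where
  module I = Interval I
  module J = Interval J

-- Contraction (b = true) or deletion (b = false) of g.  It is empty, instead of the actual
-- minor, when g is a loop to be contracted or a coloop to be deleted.
Minor : Fin (suc n) → Bool → BaseFamily (suc n) → BaseFamily n
Minor g b M B = M (insertAt B g b)

-- Removing step `g` merges the points just before and just after it, so position `toℕ g` inherits
-- the conditions of both.
Interval-Minor : {M : BaseFamily (suc n)} → ∀ g b → Interval M → Interval (Minor g b M)
Interval-Minor {n} {M} g b I = record
  { R      = λ i c → (i ≤ toℕ g → R i c) × (toℕ g ≤ i → R (suc i) (step b c))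
  ; R?     = λ i c → ((i ≤? toℕ g) →-dec R? i c) ×-dec ((toℕ g ≤? i) →-dec R? (suc i) (step b c))
  ; convex = λ i x≤y y≤z (Rx , R′x) (Rz , R′z) →
      (λ i≤g → convex i x≤y y≤z (Rx i≤g) (Rz i≤g)) ,
      (λ g≤i → convex (suc i) (step-mono b x≤y) (step-mono b y≤z) (R′x g≤i) (R′z g≤i))
  ; card   = λ {A} {B} MA MB → step-injective b
      (trans (sym (∣insertAt∣ A g b)) (trans (card MA MB) (∣insertAt∣ B g b)))
  ; char   = λ B → mk⇔
      (λ MB i i≤n →
        (λ i≤g → subst (R i) (prefixCount-insertAt-≤ B g b i≤g)
                   (to (char _) MB i (≤-trans i≤n (n≤1+n n)))) ,
        (λ g≤i → subst (R (suc i)) (prefixCount-insertAt-≥ B g b g≤i)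
                   (to (char _) MB (suc i) (s≤s i≤n))))
      (λ h → from (char _) (satisfies B h))
  }
  where
  open Interval I
  satisfies : ∀ B → (∀ i → i ≤ n → (i ≤ toℕ g → R i (prefixCount i B)) ×
                                     (toℕ g ≤ i → R (suc i) (step b (prefixCount i B)))) →
              ∀ i → i ≤ suc n → R i (prefixCount i (insertAt B g b))
  satisfies B h i i≤1+n with i ≤? toℕ g
  ... | yes i≤g = subst (R i) (sym (prefixCount-insertAt-≤ B g b i≤g))
                    (proj₁ (h i (≤-trans i≤g (toℕ≤pred[n] g))) i≤g)
  satisfies B h zero    _         | no i≰g = contradiction z≤n i≰g
  satisfies B h (suc i) (s≤s i≤n) | no i≰g with ≰⇒> i≰g
  ... | s≤s g≤i = subst (R (suc i)) (sym (prefixCount-insertAt-≥ B g b g≤i)) (proj₂ (h i i≤n) g≤i)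

Coloop : BaseFamily n → BaseFamily (suc n)
Coloop M (true  ∷ B) = M B
Coloop M (false ∷ B) = ⊥

Interval-Coloop : {M : BaseFamily n} → Interval M → Interval (Coloop M)
Interval-Coloop {n} {M} I = record
  { R      = R′
  ; R?     = R′?
  ; convex = convex′
  ; card   = λ { {true ∷ A} {true ∷ B} MA MB → cong suc (card MA MB) }
  ; char   = λ where
      (true ∷ B)  → mk⇔ (λ { MB zero _ → tt ; MB (suc i) (s≤s i≤n) → to (char B) MB i i≤n })
                        (λ h → from (char B) (λ i i≤n → h (suc i) (s≤s i≤n)))
      (false ∷ B) → mk⇔ (λ ()) (λ h → h 1 (s≤s z≤n))
  }
  where
  open Interval I
  -- All conditions move by one position and one north step; count zero at a positive position means
  -- that the coloop was left out.
  R′ : ℕ → ℕ → Set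
  R′ zero    c       = ⊤
  R′ (suc i) zero    = ⊥
  R′ (suc i) (suc c) = R i c
  R′? : ∀ i c → Dec (R′ i c)
  R′? zero    c       = yes tt
  R′? (suc i) zero    = no λ ()
  R′? (suc i) (suc c) = R? i c
  convex′ : ∀ i {a b c} → a ≤ b → b ≤ c → R′ i a → R′ i c → R′ i b
  convex′ zero    _         _         _  _  = tt
  convex′ (suc i) (s≤s a≤b) (s≤s b≤c) Ra Rc = convex i a≤b b≤c Ra Rc

-- Exchange along lattice paths

Between : ℕ → ℕ → ℕ → Set
Between a b c = (a ≤ b × b ≤ c) ⊎ (c ≤ b × b ≤ a)

-- A prefix count with a starting height, so that an induction can pass the first step and keep the
-- height reached.
tally : ℕ → ℕ → Subset n → ℕ
tally c zero    _       = c
tally c (suc i) []      = c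
tally c (suc i) (b ∷ B) = tally (step b c) i B

tally-+ : ∀ c i (B : Subset n) → tally c i B ≡ c + prefixCount i B
tally-+ c zero    B           = sym (+-identityʳ c)
tally-+ c (suc i) []          = sym (+-identityʳ c)
tally-+ c (suc i) (true  ∷ B) = trans (tally-+ (suc c) i B) (sym (+-suc c _))
tally-+ c (suc i) (false ∷ B) = tally-+ c i B

Between-at-left : ∀ {a c} → Between a a c
Between-at-left {a} {c} with ≤-total a c
... | inj₁ a≤c = inj₁ (≤-refl , a≤c)
... | inj₂ c≤a = inj₂ (c≤a , ≤-refl)

+-∣∷∣ : ∀ c b (B : Subset n) → c + ∣ b ∷ B ∣ ≡ step b c + ∣ B ∣
+-∣∷∣ c true  B = +-suc c ∣ B ∣
+-∣∷∣ c false B = refl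

∣∷∣-balance : ∀ a b s t (A B : Subset n) → a + ∣ s ∷ A ∣ ≡ b + ∣ t ∷ B ∣ →
              step s a + ∣ A ∣ ≡ step t b + ∣ B ∣
∣∷∣-balance a b s t A B eq = trans (sym (+-∣∷∣ a s A)) (trans eq (+-∣∷∣ b t B))

-- A path A that starts strictly above a path B and ends where B does has to
-- meet B; the exchanged step is the one at which they first meet.
exchange-after : ∀ a b (A B : Subset n) → b ≤ a → suc a + ∣ A ∣ ≡ b + ∣ B ∣ →
  ∃[ y ] (B ∋ y × A ∌ y ×
          ∀ i → Between (tally (suc a) i A) (tally a i (A [ y ]≔ true)) (tally b i B))
exchange-after a b [] [] b≤a eq rewrite +-identityʳ a | +-identityʳ b =
  contradiction (subst (_≤ a) (sym eq) b≤a) 1+n≰n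
exchange-after a b (true ∷ A) (true ∷ B) b≤a eq
  with exchange-after (suc a) (suc b) A B (s≤s b≤a) (∣∷∣-balance (suc a) b true true A B eq)
... | y , B∋y , A∌y , btw =
  suc y , B∋y , A∌y , λ { zero → inj₂ (b≤a , n≤1+n a) ; (suc i) → btw i }
exchange-after a b (true ∷ A) (false ∷ B) b≤a eq
  with exchange-after (suc a) b A B (m≤n⇒m≤1+n b≤a) (∣∷∣-balance (suc a) b true false A B eq)
... | y , B∋y , A∌y , btw =
  suc y , B∋y , A∌y , λ { zero → inj₂ (b≤a , n≤1+n a) ; (suc i) → btw i }
exchange-after a b (false ∷ A) (false ∷ B) b≤a eq
  with exchange-after a b A B b≤a eq
... | y , B∋y , A∌y , btw =
  suc y , B∋y , A∌y , λ { zero → inj₂ (b≤a , n≤1+n a) ; (suc i) → btw i }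
exchange-after a b (false ∷ A) (true ∷ B) b≤a eq with m≤n⇒m<n∨m≡n b≤a
... | inj₂ refl = zero , refl , refl , λ { zero → inj₂ (≤-refl , n≤1+n a) ; (suc i) → Between-at-left }
... | inj₁ b<a with exchange-after a (suc b) A B b<a (∣∷∣-balance (suc a) b false true A B eq)
...   | y , B∋y , A∌y , btw =
  suc y , B∋y , A∌y , λ { zero → inj₂ (b≤a , n≤1+n a) ; (suc i) → btw i }

Exchanged : ℕ → ℕ → Subset n → Subset n → Fin n → Set
Exchanged a b A B x =
  ∃[ y ] (B ∋ y × A ∌ y × ∀ i → Between (tally a i A) (tally a i (A ⟨ x ↦ y ⟩)) (tally b i B))

-- The element to be exchanged with x precedes the current position.
Pending : ℕ → ℕ → Subset n → Subset n → Fin n → Set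
Pending a b A B x =
  a < b × ∀ i → Between (tally a i A) (tally (suc a) i (A [ x ]≔ false)) (tally b i B)

-- The side on which `A` runs just before `x` decides where `y` lies. If `A` is not below `B`,
-- dropping `x` lowers it towards `B`, and `y` is found after `x`. If `A` is below, a stretch before
-- `x` has to be raised instead: `Pending` is carried back to the last point before `x` at which the
-- paths agree, where `A` goes east and `B` north.
exchange-path : ∀ a b (A B : Subset n) x → A ∋ x → B ∌ x → a + ∣ A ∣ ≡ b + ∣ B ∣ →
                Exchanged a b A B x ⊎ Pending a b A B x
exchange-path a b (true ∷ A) (false ∷ B) zero A∋x B∌x eq with a <? b
... | yes a<b = inj₂ (a<b , λ { zero → inj₁ (n≤1+n a , a<b) ; (suc i) → Between-at-left })
... | no  a≮b with exchange-after a b A B (≮⇒≥ a≮b) (∣∷∣-balance a b true false A B eq)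
...   | y , B∋y , A∌y , btw =
  inj₁ (suc y , B∋y , A∌y , λ { zero → Between-at-left ; (suc i) → btw i })
exchange-path a b (s ∷ A) (t ∷ B) (suc x) A∋x B∌x eq
  with exchange-path (step s a) (step t b) A B x A∋x B∌x (∣∷∣-balance a b s t A B eq)
... | inj₁ (y , B∋y , A∌y , btw) =
  inj₁ (suc y , B∋y , A∌y , λ { zero → Between-at-left ; (suc i) → btw i })
exchange-path a b (true ∷ A) (true ∷ B) (suc x) A∋x B∌x eq | inj₂ (s≤s a<b , btw) =
  inj₂ (a<b , λ { zero → inj₁ (n≤1+n a , a<b) ; (suc i) → btw i })
exchange-path a b (true ∷ A) (false ∷ B) (suc x) A∋x B∌x eq | inj₂ (1+a<b , btw) =
  inj₂ (<⇒≤ 1+a<b , λ { zero → inj₁ (n≤1+n a , <⇒≤ 1+a<b) ; (suc i) → btw i })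
exchange-path a b (false ∷ A) (false ∷ B) (suc x) A∋x B∌x eq | inj₂ (a<b , btw) =
  inj₂ (a<b , λ { zero → inj₁ (n≤1+n a , a<b) ; (suc i) → btw i })
exchange-path a b (false ∷ A) (true ∷ B) (suc x) A∋x B∌x eq | inj₂ (s≤s a≤b , btw)
  with m≤n⇒m<n∨m≡n a≤b
... | inj₁ a<b = inj₂ (a<b , λ { zero → inj₁ (n≤1+n a , a<b) ; (suc i) → btw i })
... | inj₂ refl = inj₁ (zero , refl , refl , λ { zero → Between-at-left ; (suc i) → btw i })

Interval-Exchange : {M : BaseFamily n} → Interval M → Exchange M
Interval-Exchange {M = M} I {A} {B} MA MB {x} A∋x B∌x
  with exchange-path 0 0 A B x A∋x B∌x (Interval.card I MA MB)
-- `Pending 0 0` is impossible, as both paths start at the origin.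
... | inj₁ (y , B∋y , A∌y , btw) =
  y , B∋y , A∌y , from (char _) λ i i≤n →
    between i (btw i) (to (char A) MA i i≤n) (to (char B) MB i i≤n)
  where
  open Interval I
  between : ∀ i {C} → Between (tally 0 i A) (tally 0 i C) (tally 0 i B) →
            R i (prefixCount i A) → R i (prefixCount i B) → R i (prefixCount i C)
  between i {C} btw RA RB rewrite tally-+ 0 i A | tally-+ 0 i B | tally-+ 0 i C with btw
  ... | inj₁ (A≤C , C≤B) = convex i A≤C C≤B RA RB
  ... | inj₂ (B≤C , C≤A) = convex i B≤C C≤A RB RA

-- Interval families are lattice path matroids

path : ∀ n → (ℕ → ℕ) → Subset n
path zero    h = []
path (suc n) h = (h 0 <ᵇ h 1) ∷ path n (h ∘ suc)

step-<ᵇ : ∀ {a b} → a ≤ b → b ≤ suc a → step (a <ᵇ b) a ≡ b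
step-<ᵇ {zero}  {zero}  _         _         = refl
step-<ᵇ {zero}  {suc _} _         (s≤s z≤n) = refl
step-<ᵇ {suc a} {suc b} (s≤s a≤b) (s≤s b≤a) =
  trans (step-comm (a <ᵇ b) true a) (cong suc (step-<ᵇ a≤b b≤a))

UnitSteps : (ℕ → ℕ) → Set
UnitSteps h = ∀ i → h i ≤ h (suc i) × h (suc i) ≤ suc (h i)

prefixCount-path : ∀ {h} → UnitSteps h → ∀ {i} → i ≤ n → h 0 + prefixCount i (path n h) ≡ h i
prefixCount-path             st {zero}  _ = +-identityʳ _
prefixCount-path {suc n} {h} st {suc i} (s≤s i≤n) =
  trans (sym (tally-+ (h 0) (suc i) (path (suc n) h)))
  (trans (cong (λ c → tally c i (path n (h ∘ suc))) (step-<ᵇ (proj₁ (st 0)) (proj₂ (st 0))))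
  (trans (tally-+ (h 1) i (path n (h ∘ suc))) (prefixCount-path (st ∘ suc) i≤n)))

-- What maximum and minimum share. Taken pointwise of two paths they again make unit steps (`mono`,
-- `suc-homo`), and at each position the result passes through a point of one of the two paths
-- (`selective`), so conditions imposed position by position survive.
record Combination (_⊙_ : ℕ → ℕ → ℕ) : Set where
  field
    at-zero   : 0 ⊙ 0 ≡ 0
    suc-homo  : ∀ a b → suc a ⊙ suc b ≡ suc (a ⊙ b)
    mono      : ∀ {a b c d} → a ≤ b → c ≤ d → a ⊙ c ≤ b ⊙ d
    selective : ∀ a b → a ⊙ b ≡ a ⊎ a ⊙ b ≡ b

⊔-combination : Combination _⊔_
⊔-combination = record
  { at-zero = refl ; suc-homo = λ _ _ → refl ; mono = ⊔-mono-≤ ; selective = ⊔-sel }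

⊓-combination : Combination _⊓_
⊓-combination = record
  { at-zero = refl ; suc-homo = λ _ _ → refl ; mono = ⊓-mono-≤ ; selective = ⊓-sel }

module _ {_⊙_ : ℕ → ℕ → ℕ} (comb : Combination _⊙_) where
  open Combination comb

  combine : Subset n → Subset n → Subset n
  combine {n} P Q = path n (λ i → prefixCount i P ⊙ prefixCount i Q)

  prefixCount-combine : ∀ i (P Q : Subset n) →
                        prefixCount i (combine P Q) ≡ prefixCount i P ⊙ prefixCount i Q
  prefixCount-combine {n} i P Q
    rewrite prefixCount-⊓ i P | prefixCount-⊓ i Q | prefixCount-⊓ i (combine P Q) =
    trans (cong (_+ prefixCount (i ⊓ n) (combine P Q)) (sym at-zero))
      (prefixCount-path (λ j → mono (prefixCount-suc-≥ j P) (prefixCount-suc-≥ j Q) ,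
        ≤-trans (mono (prefixCount-suc-≤ j P) (prefixCount-suc-≤ j Q)) (≤-reflexive (suc-homo _ _)))
        (m⊓n≤n i n))

  combine-closed : {M : BaseFamily n} → Interval M → ∀ {P Q} → M P → M Q → M (combine P Q)
  combine-closed I {P} {Q} MP MQ = from (char _) λ i i≤n →
      subst (R i) (sym (prefixCount-combine i P Q)) (select i i≤n)
    where
    open Interval I
    select : ∀ i → i ≤ _ → R i (prefixCount i P ⊙ prefixCount i Q)
    select i i≤n with selective (prefixCount i P) (prefixCount i Q)
    ... | inj₁ eq = subst (R i) (sym eq) (to (char P) MP i i≤n)
    ... | inj₂ eq = subst (R i) (sym eq) (to (char Q) MQ i i≤n)

-- An exhaustive search over all subsets: `go` joins the optima of the two halves, `f` being the
-- choice made for the elements already treated.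
extremal : ∀ {M : BaseFamily n} → (∀ B → Dec (M B)) → ∃ M →
           {_≼_ : Subset n → Subset n → Set} → (∀ {A B C} → A ≼ B → B ≼ C → A ≼ C) → (∀ {A} → A ≼ A) →
           {_∨_ : Subset n → Subset n → Subset n} →
           (∀ {A B} → M A → M B → M (A ∨ B)) → (∀ A B → A ≼ (A ∨ B)) → (∀ A B → B ≼ (A ∨ B)) →
           ∃[ U ] (M U × ∀ B → M B → B ≼ U)
extremal {n} {M} M? (A₀ , MA₀) {_≼_} ≼-trans ≼-refl {_∨_} closed ≼-∨ˡ ≼-∨ʳ = go n id
  where
  go : ∀ k (f : Subset k → Subset n) → ∃[ U ] (M U × ∀ B → M (f B) → f B ≼ U)
  go zero f with M? (f [])
  ... | yes Mf = f [] , Mf , λ { [] _ → ≼-refl }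
  -- A subset that is no base contributes the default `A₀`; being a base, it can be joined in
  -- without leaving `M`.
  ... | no ¬Mf = A₀ , MA₀ , λ { [] Mf → contradiction Mf ¬Mf }
  go (suc k) f with go k (f ∘ (true ∷_)) | go k (f ∘ (false ∷_))
  ... | U , MU , ≼U | V , MV , ≼V = U ∨ V , closed MU MV , λ where
    (true  ∷ B) Mf → ≼-trans (≼U B Mf) (≼-∨ˡ U V)
    (false ∷ B) Mf → ≼-trans (≼V B Mf) (≼-∨ʳ U V)

-- With `U` the highest and `L` the lowest base, a path between them has each count between two
-- admissible ones, and convexity makes it a base.
Interval⇒IsLPM : {M : BaseFamily n} → Interval M → ∃ M → IsLPM M
Interval⇒IsLPM {n} {M} I inh
  with extremal decidable inh {WeaklyBelow} (λ A≤B B≤C i → ≤-trans (A≤B i) (B≤C i)) (λ i → ≤-refl)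
         (combine-closed ⊔-combination I)
         (λ A B i → ≤-trans (m≤m⊔n _ _) (≤-reflexive (sym (prefixCount-combine ⊔-combination i A B))))
         (λ A B i → ≤-trans (m≤n⊔m _ _) (≤-reflexive (sym (prefixCount-combine ⊔-combination i A B))))
     | extremal decidable inh {λ A B → WeaklyBelow B A}
         (λ B≤A C≤B i → ≤-trans (C≤B i) (B≤A i)) (λ i → ≤-refl)
         (combine-closed ⊓-combination I)
         (λ A B i → ≤-trans (≤-reflexive (prefixCount-combine ⊓-combination i A B)) (m⊓n≤m _ _))
         (λ A B i → ≤-trans (≤-reflexive (prefixCount-combine ⊓-combination i A B)) (m⊓n≤n _ _))
  where open Interval I
... | U , MU , ≤U | L , ML , L≤ =
  ∣ U ∣ , U , L , refl , card ML MU , L≤ U MU , id , ((λ eq → eq) , (λ y → y , id)) , λ B →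
  mk⇔ (λ (_ , B≤U , L≤B) → subst M (sym (tabulate∘lookup B))
         (from (char B) λ i i≤n →
           convex i (L≤B i) (B≤U i) (to (char L) ML i i≤n) (to (char U) MU i i≤n)))
      (λ MB′ → let MB = subst M (tabulate∘lookup B) MB′ in card MB MU , ≤U B MB , L≤ B MB)
  where open Interval I

≡⇒⇔ : (M : BaseFamily n) {A B : Subset n} → A ≡ B → M A ⇔ M B
≡⇒⇔ M refl = ⇔-id _

-- Relabelling

_◃_ : ∀ {m n} → Permutation m n → Subset n → Subset m
π ◃ B = preimage (π ⟨$⟩ʳ_) B

infixr 7 _◃_

lookup-◃ : ∀ {m n} (π : Permutation m n) B i → lookup (π ◃ B) i ≡ lookup B (π ⟨$⟩ʳ i)
lookup-◃ π B i = lookup∘tabulate _ i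

◃-∁ : ∀ {m n} (π : Permutation m n) B → π ◃ ∁ B ≡ ∁ (π ◃ B)
◃-∁ π B = lookup-ext λ i →
  trans (lookup-◃ π (∁ B) i) (trans (lookup-map (π ⟨$⟩ʳ i) not B)
  (sym (trans (lookup-map i not (π ◃ B)) (cong not (lookup-◃ π B i)))))

◃-flip : ∀ {m n} (π : Permutation m n) B → π ◃ flip π ◃ B ≡ B
◃-flip π B = lookup-ext λ i →
  trans (lookup-◃ π (flip π ◃ B) i) (trans (lookup-◃ (flip π) B _) (cong (lookup B) (inverseˡ π)))

◃-update : ∀ {m n} (π : Permutation m n) B i b → π ◃ (B [ π ⟨$⟩ʳ i ]≔ b) ≡ (π ◃ B) [ i ]≔ b
◃-update π B i b = lookup-ext λ j → trans (lookup-◃ π (B [ π ⟨$⟩ʳ i ]≔ b) j) (pointwise j)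
  where
  pointwise : ∀ j → lookup (B [ π ⟨$⟩ʳ i ]≔ b) (π ⟨$⟩ʳ j) ≡ lookup ((π ◃ B) [ i ]≔ b) j
  pointwise j with j ≟ i
  ... | yes refl = trans (lookup∘update (π ⟨$⟩ʳ j) B b) (sym (lookup∘update j (π ◃ B) b))
  ... | no j≢i = trans
    (lookup∘update′
      (λ eq → j≢i (trans (sym (inverseˡ π)) (trans (cong (π ⟨$⟩ˡ_) eq) (inverseˡ π)))) B b)
    (sym (trans (lookup∘update′ j≢i (π ◃ B) b) (lookup-◃ π B j)))

insertAt-ext : ∀ {A : Set} {xs : Vec A (suc n)} {ys : Vec A n} k {a} → lookup xs k ≡ a →
               (∀ j → lookup xs (punchIn k j) ≡ lookup ys j) → xs ≡ insertAt ys k a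
insertAt-ext {xs = xs} {ys} k {a} at-k off-k = lookup-ext pointwise
  where
  pointwise : ∀ i → lookup xs i ≡ lookup (insertAt ys k a) i
  pointwise i with k ≟ i
  ... | yes refl = trans at-k (sym (insertAt-lookup ys k a))
  ... | no k≢i = subst (λ i → lookup xs i ≡ lookup (insertAt ys k a) i) (punchIn-punchOut k≢i)
                   (trans (off-k (punchOut k≢i)) (sym (insertAt-punchIn ys k a (punchOut k≢i))))

◃-insertAt : ∀ {m n} (π : Permutation (suc m) (suc n)) B g b →
             π ◃ insertAt B g b ≡ insertAt (remove (π ⟨$⟩ˡ g) π ◃ B) (π ⟨$⟩ˡ g) b
◃-insertAt π B g b = insertAt-ext (π ⟨$⟩ˡ g)
  (trans (lookup-◃ π (insertAt B g b) _)
    (trans (cong (lookup (insertAt B g b)) (inverseʳ π)) (insertAt-lookup B g b)))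
  (λ j → trans (lookup-◃ π (insertAt B g b) _)
    (trans (cong (lookup (insertAt B g b)) (punchIn-permute′ π g j))
    (trans (insertAt-punchIn B g b _) (sym (lookup-◃ (remove (π ⟨$⟩ˡ g) π) B j)))))

toFront : Fin (suc n) → Permutation′ (suc n)
toFront g = insert g zero idₚ

toFront-◃ : ∀ g b (B : Subset n) → toFront g ◃ (b ∷ B) ≡ insertAt B g b
toFront-◃ g b B = insertAt-ext g
  (trans (lookup-◃ (toFront g) (b ∷ B) g) (cong (lookup (b ∷ B)) at-g))
  (λ j → trans (lookup-◃ (toFront g) (b ∷ B) _) (cong (lookup (b ∷ B)) (insert-punchIn g zero idₚ j)))
  where
  at-g : toFront g ⟨$⟩ʳ g ≡ zero
  at-g with g ≟ g
  ... | yes _  = refl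
  ... | no g≢g = contradiction refl g≢g

Relabels : ∀ {m n} → Permutation m n → BaseFamily m → BaseFamily n → Set
Relabels π M M′ = ∀ B → M′ B ⇔ M (π ◃ B)

Relabels-flip : ∀ {m n} (π : Permutation m n) {M M′} → Relabels π M M′ → Relabels (flip π) M′ M
Relabels-flip π {M} rel B = ⇔-sym (≡⇒⇔ M (◃-flip π B) ⇔-∘ rel (flip π ◃ B))

Relabels-dual : ∀ {m n} (π : Permutation m n) {M M′} → Relabels π M M′ → Relabels π (dual M) (dual M′)
Relabels-dual π {M} rel B = ≡⇒⇔ M (◃-∁ π B) ⇔-∘ rel (∁ B)

Relabels-Exchange : ∀ {m n} (π : Permutation m n) {M M′} → Relabels π M M′ → Exchange M → Exchange M′
Relabels-Exchange π {M} rel ex {A} {B} MA MB {x} A∋x B∌x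
  with ex (to (rel A) MA) (to (rel B) MB) {π ⟨$⟩ˡ x} (trans (at A) A∋x) (trans (at B) B∌x)
  where
  at : ∀ C → lookup (π ◃ C) (π ⟨$⟩ˡ x) ≡ lookup C x
  at C = trans (lookup-◃ π C _) (cong (lookup C) (inverseʳ π))
... | y , B∋y , A∌y , MA′ =
  π ⟨$⟩ʳ y , trans (sym (lookup-◃ π B y)) B∋y , trans (sym (lookup-◃ π A y)) A∌y ,
  from (rel _) (subst M (sym moved) MA′)
  where
  moved : π ◃ (A ⟨ x ↦ π ⟨$⟩ʳ y ⟩) ≡ (π ◃ A) ⟨ π ⟨$⟩ˡ x ↦ y ⟩
  moved = trans (◃-update π (A [ x ]≔ false) y true) (cong (_[ y ]≔ true)
    (trans (cong (λ z → π ◃ (A [ z ]≔ false)) (sym (inverseʳ π))) (◃-update π A (π ⟨$⟩ˡ x) false)))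

-- Loops, coloops and parallel pairs

Loop : BaseFamily n → BaseFamily (suc n)
Loop M (true  ∷ B) = ⊥
Loop M (false ∷ B) = M B

-- Adds a new first element parallel to the old first element of M
-- (a loop, if that element is one).
Parallel : BaseFamily (suc n) → BaseFamily (suc (suc n))
Parallel M (false ∷ b     ∷ B) = M (b ∷ B)
Parallel M (true  ∷ false ∷ B) = M (true ∷ B)
Parallel M (true  ∷ true  ∷ B) = ⊥

-- If one set contains one copy and the other set the other copy, the copies are exchanged for each
-- other. Otherwise exchange in `M` applies, and when it asks for the doubled element, the answer is
-- the copy lying in `B`.
Parallel-Exchange : {M : BaseFamily (suc n)} → Exchange M → Exchange (Parallel M)
Parallel-Exchange ex {true ∷ false ∷ A} {false ∷ true ∷ B} MA MB {zero} _ _ =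
  suc zero , refl , refl , MA
Parallel-Exchange ex {true ∷ false ∷ A} {false ∷ false ∷ B} MA MB {zero} _ _
  with ex MA MB {zero} refl refl
... | suc y , B∋y , A∌y , MA′ = suc (suc y) , B∋y , A∌y , MA′
Parallel-Exchange ex {false ∷ true ∷ A} {true ∷ false ∷ B} MA MB {suc zero} _ _ =
  zero , refl , refl , MA
Parallel-Exchange ex {false ∷ true ∷ A} {false ∷ false ∷ B} MA MB {suc zero} _ _
  with ex MA MB {zero} refl refl
... | suc y , B∋y , A∌y , MA′ = suc (suc y) , B∋y , A∌y , MA′
Parallel-Exchange ex {true ∷ false ∷ A} {true ∷ false ∷ B} MA MB {suc (suc x)} A∋x B∌x
  with ex MA MB {suc x} A∋x B∌x
... | suc y , B∋y , A∌y , MA′ = suc (suc y) , B∋y , A∌y , MA′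
Parallel-Exchange ex {true ∷ false ∷ A} {false ∷ b ∷ B} MA MB {suc (suc x)} A∋x B∌x
  with ex MA MB {suc x} A∋x B∌x
... | suc y , B∋y , A∌y , MA′ = suc (suc y) , B∋y , A∌y , MA′
Parallel-Exchange ex {false ∷ a ∷ A} {true ∷ false ∷ B} MA MB {suc (suc x)} A∋x B∌x
  with ex MA MB {suc x} A∋x B∌x
... | suc y , B∋y , A∌y , MA′ = suc (suc y) , B∋y , A∌y , MA′
Parallel-Exchange ex {false ∷ false ∷ A} {true ∷ false ∷ B} MA MB {suc (suc x)} A∋x B∌x
    | zero , _ , _ , MA′ = zero , refl , refl , MA′
Parallel-Exchange ex {false ∷ a ∷ A} {false ∷ b ∷ B} MA MB {suc (suc x)} A∋x B∌x
  with ex MA MB {suc x} A∋x B∌x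
... | zero , B∋y , A∌y , MA′ = suc zero , B∋y , A∌y , MA′
... | suc y , B∋y , A∌y , MA′ = suc (suc y) , B∋y , A∌y , MA′

-- A description of spex(LPM) in which parallel extensions act on the first two
-- elements only, and series extensions are duals of parallel extensions.

data Sp : BaseFamily n → Set₁ where
  interval : {M : BaseFamily n} → Interval M → ∃ M → Sp M
  parallel : {M : BaseFamily (suc n)} → Sp M → ∃ (Minor zero true M) → Sp (Parallel M)
  dualise  : {M : BaseFamily n} → Sp M → Sp (dual M)
  relabel  : {M M′ : BaseFamily n} (π : Permutation′ n) → Relabels π M M′ → Sp M → Sp M′

Sp-≈ : {M M′ : BaseFamily n} → M′ ≈M M → Sp M → Sp M′
Sp-≈ {M = M} eq = relabel idₚ λ B → ≡⇒⇔ M (sym (tabulate∘lookup B)) ⇔-∘ eq B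

Sp-undual : {M : BaseFamily n} → Sp (dual M) → Sp M
Sp-undual {M = M} s = Sp-≈ (λ B → ≡⇒⇔ M (sym (∁-involutive B))) (dualise s)

Front : Fin (suc n) → BaseFamily (suc n) → BaseFamily (suc n)
Front g M (b ∷ B) = M (insertAt B g b)

Front-Relabels : ∀ g (M : BaseFamily (suc n)) → Relabels (toFront g) M (Front g M)
Front-Relabels g M (b ∷ B) = ≡⇒⇔ M (sym (toFront-◃ g b B))

Sp-Front : ∀ g {M : BaseFamily (suc n)} → Sp M → Sp (Front g M)
Sp-Front g {M} = relabel (toFront g) (Front-Relabels g M)

Sp-Front⁻ : ∀ g {M : BaseFamily (suc n)} → Sp (Front g M) → Sp M
Sp-Front⁻ g {M} = relabel (flip (toFront g)) (Relabels-flip (toFront g) (Front-Relabels g M))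

Sp-inhabited : {M : BaseFamily n} → Sp M → ∃ M
Sp-inhabited (interval _ inh) = inh
Sp-inhabited (parallel s (B , MB)) = false ∷ true ∷ B , MB
Sp-inhabited (dualise {M = M} s) with Sp-inhabited s
... | B , MB = ∁ B , subst M (sym (∁-involutive B)) MB
Sp-inhabited (relabel {M = M} π rel s) with Sp-inhabited s
... | B , MB = flip π ◃ B , from (rel _) (subst M (sym (◃-flip π B)) MB)

Sp-decidable : {M : BaseFamily n} → Sp M → ∀ B → Dec (M B)
Sp-decidable (interval I _)    B                    = Interval.decidable I B
Sp-decidable (parallel s _)    (false ∷ b     ∷ B)  = Sp-decidable s (b ∷ B)
Sp-decidable (parallel s _)    (true  ∷ false ∷ B)  = Sp-decidable s (true ∷ B)
Sp-decidable (parallel s _)    (true  ∷ true  ∷ B)  = no λ ()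
Sp-decidable (dualise s)       B                    = Sp-decidable s (∁ B)
Sp-decidable (relabel π rel s) B                    = map-dec (⇔-sym (rel B)) (Sp-decidable s (π ◃ B))

Sp-Exchange : {M : BaseFamily n} → Sp M → Exchange M
Sp-Exchange (interval I _) = Interval-Exchange I
Sp-Exchange (parallel {M = M} s _) {A} {B} = Parallel-Exchange {M = M} (Sp-Exchange s) {A} {B}
Sp-Exchange (dualise {M = M} s) = dual-Exchange {M = M} (Sp-Exchange s)
Sp-Exchange (relabel {M = M} {M′} π rel s) = Relabels-Exchange π {M} {M′} rel (Sp-Exchange s)

-- Closure under loops, coloops and minors

Loop-dual : (M : BaseFamily n) → Loop (dual M) ≈M dual (Coloop M)
Loop-dual M (true  ∷ B) = ⇔-id _
Loop-dual M (false ∷ B) = ⇔-id _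

Coloop-dual : (M : BaseFamily n) → Coloop (dual M) ≈M dual (Loop M)
Coloop-dual M (true  ∷ B) = ⇔-id _
Coloop-dual M (false ∷ B) = ⇔-id _

-- Duality turns coloops into loops, so the `dualise` case makes the two closures a mutual
-- induction.
Sp-Coloop : {M : BaseFamily n} → Sp M → Sp (Coloop M)
Sp-Loop   : {M : BaseFamily n} → Sp M → Sp (Loop M)

Sp-Coloop (interval I (B , MB)) = interval (Interval-Coloop I) (true ∷ B , MB)
-- `Parallel` doubles the element in front, where the coloop now is. So the old element is brought
-- to the front and doubled, and the coloop, by then at position two, is moved back.
Sp-Coloop (parallel {M = M} s (B , MB)) = Sp-≈ commute
    (Sp-Front (suc (suc zero)) (parallel (Sp-Front (suc zero) (Sp-Coloop s)) (true ∷ B , MB)))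
  where
  commute : Coloop (Parallel M) ≈M Front (suc (suc zero)) (Parallel (Front (suc zero) (Coloop M)))
  commute (true  ∷ false ∷ b     ∷ B) = ⇔-id _
  commute (true  ∷ true  ∷ false ∷ B) = ⇔-id _
  commute (true  ∷ true  ∷ true  ∷ B) = ⇔-id _
  commute (false ∷ false ∷ b     ∷ B) = ⇔-id _
  commute (false ∷ true  ∷ false ∷ B) = ⇔-id _
  commute (false ∷ true  ∷ true  ∷ B) = ⇔-id _
Sp-Coloop (dualise {M = M} s) = Sp-≈ (Coloop-dual M) (dualise (Sp-Loop s))
Sp-Coloop (relabel π rel s) = relabel (lift₀ π)
  (λ { (true ∷ B) → rel B ; (false ∷ B) → ⇔-id _ }) (Sp-Coloop s)

Sp-Loop (interval {M = M} I (B , MB)) = Sp-undual (Sp-≈ dual-Loop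
    (interval (Interval-Coloop (Interval-dual I)) (true ∷ ∁ B , subst M (sym (∁-involutive B)) MB)))
  where
  dual-Loop : dual (Loop M) ≈M Coloop (dual M)
  dual-Loop B = ⇔-sym (Coloop-dual M B)
Sp-Loop (parallel {M = M} s (B , MB)) = Sp-≈ commute
    (Sp-Front (suc (suc zero)) (parallel (Sp-Front (suc zero) (Sp-Loop s)) (false ∷ B , MB)))
  where
  commute : Loop (Parallel M) ≈M Front (suc (suc zero)) (Parallel (Front (suc zero) (Loop M)))
  commute (true  ∷ false ∷ b     ∷ B) = ⇔-id _
  commute (true  ∷ true  ∷ false ∷ B) = ⇔-id _
  commute (true  ∷ true  ∷ true  ∷ B) = ⇔-id _
  commute (false ∷ false ∷ b     ∷ B) = ⇔-id _
  commute (false ∷ true  ∷ false ∷ B) = ⇔-id _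
  commute (false ∷ true  ∷ true  ∷ B) = ⇔-id _
Sp-Loop (dualise {M = M} s) = Sp-≈ (Loop-dual M) (dualise (Sp-Coloop s))
Sp-Loop (relabel π rel s) = relabel (lift₀ π)
  (λ { (true ∷ B) → ⇔-id _ ; (false ∷ B) → rel B }) (Sp-Loop s)

-- Doubling a loop yields another loop and not a parallel pair, hence the case distinction, which
-- rests on `Sp-decidable`.
Sp-Parallel : {M : BaseFamily (suc n)} → Sp M → Sp (Parallel M)
Sp-Parallel {M = M} s with anySubset? (λ B → Sp-decidable s (true ∷ B))
... | yes nonloop = parallel s nonloop
... | no  isLoop  = Sp-≈ is-Loop (Sp-Loop s)
  where
  is-Loop : Parallel M ≈M Loop M
  is-Loop (false ∷ b     ∷ B) = ⇔-id _
  is-Loop (true  ∷ false ∷ B) = mk⇔ (λ MB → isLoop (B , MB)) (λ ())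
  is-Loop (true  ∷ true  ∷ B) = ⇔-id _

-- Deleting one copy of the doubled element gives back `M`; contracting one turns the other into a
-- loop. Any other minor commutes with doubling, but may make the doubled element a loop, which is
-- why `Sp-Parallel` replaces the constructor there.
Sp-Minor : {M : BaseFamily (suc n)} → Sp M → ∀ g b → ∃ (Minor g b M) → Sp (Minor g b M)
Sp-Minor (interval I _) g b inh = interval (Interval-Minor g b I) inh
Sp-Minor (dualise {M = M} s) g b (B , MB) =
    Sp-≈ commute (dualise (Sp-Minor s g (not b) (∁ B , to (commute B) MB)))
  where
  commute : Minor g b (dual M) ≈M dual (Minor g (not b) M)
  commute B = ≡⇒⇔ M (map-insertAt not b B g)
Sp-Minor (relabel {M = M} {M′} π rel s) g b (B , MB) =
    relabel ρ restrict (Sp-Minor s (π ⟨$⟩ˡ g) b (ρ ◃ B , to (restrict B) MB))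
  where
  ρ = remove (π ⟨$⟩ˡ g) π
  restrict : Relabels ρ (Minor (π ⟨$⟩ˡ g) b M) (Minor g b M′)
  restrict B = ≡⇒⇔ M (◃-insertAt π B g b) ⇔-∘ rel (insertAt B g b)
Sp-Minor (parallel s nonloop) zero false _ = Sp-≈ (λ { (b ∷ B) → ⇔-id _ }) s
Sp-Minor (parallel s nonloop) zero true _ =
  Sp-≈ (λ { (true ∷ B) → ⇔-id _ ; (false ∷ B) → ⇔-id _ }) (Sp-Loop (Sp-Minor s zero true nonloop))
Sp-Minor (parallel s nonloop) (suc zero) false _ =
  Sp-≈ (λ { (true ∷ B) → ⇔-id _ ; (false ∷ B) → ⇔-id _ }) s
Sp-Minor (parallel s nonloop) (suc zero) true _ =
  Sp-≈ (λ { (true ∷ B) → ⇔-id _ ; (false ∷ B) → ⇔-id _ }) (Sp-Loop (Sp-Minor s zero true nonloop))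
Sp-Minor (parallel {n = suc n} {M = M} s nonloop) (suc (suc g)) b (B , MB) =
    Sp-≈ commute (Sp-Parallel (Sp-Minor s (suc g) b (inhabited B MB)))
  where
  commute : Minor (suc (suc g)) b (Parallel M) ≈M Parallel (Minor (suc g) b M)
  commute (false ∷ c     ∷ B) = ⇔-id _
  commute (true  ∷ false ∷ B) = ⇔-id _
  commute (true  ∷ true  ∷ B) = ⇔-id _
  inhabited : ∀ B → Minor (suc (suc g)) b (Parallel M) B → ∃ (Minor (suc g) b M)
  inhabited (false ∷ c     ∷ B) MB = c ∷ B , MB
  inhabited (true  ∷ false ∷ B) MB = true ∷ B , MB

-- The recursion is on `n` first and on the derivation second: in the parallel case the minor comes
-- with a new derivation but has two elements fewer.
Sp-BaseCobase : ∀ n {M : BaseFamily n} → Sp M → IsBlock M → Sp (BaseCobase M)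
Sp-BaseCobase n (interval I _) block = interval (Interval-∩ I (Interval-dual I)) block
Sp-BaseCobase n (dualise {M = M} s) (B , MB , MB′) =
    Sp-≈ self-dual (Sp-BaseCobase n s (B , to (self-dual B) (MB , MB′)))
  where
  self-dual : BaseCobase (dual M) ≈M BaseCobase M
  self-dual B = mk⇔ (λ (MB , MB′) → subst M (∁-involutive B) MB′ , MB)
                    (λ (MB , MB′) → MB′ , subst M (sym (∁-involutive B)) MB)
Sp-BaseCobase n (relabel {M = M} {M′} π rel s) (B , MB) =
    relabel π rel′ (Sp-BaseCobase n s (π ◃ B , to (rel′ B) MB))
  where
  rel′ : Relabels π (BaseCobase M) (BaseCobase M′)
  rel′ B = mk⇔ (λ (MB , MB′) → to (rel B) MB , to (Relabels-dual π {M} {M′} rel B) MB′)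
               (λ (MB , MB′) → from (rel B) MB , from (Relabels-dual π {M} {M′} rel B) MB′)
Sp-BaseCobase (suc (suc k)) (parallel {M = M} s nonloop) block =
    Sp-≈ split (parallel (Sp-Coloop ih) (Sp-inhabited ih))
  where
  M/0 = Minor zero true M
  restrict : ∀ B → BaseCobase (Parallel M) B → IsBlock M/0
  restrict (false ∷ true  ∷ B) (MB , MB′) = B , MB , MB′
  restrict (true  ∷ false ∷ B) (MB , MB′) = B , MB , MB′
  ih : Sp (BaseCobase M/0)
  ih = Sp-BaseCobase k (Sp-Minor s zero true nonloop) (restrict (proj₁ block) (proj₂ block))
  -- A base and its complement contain one copy each, so both use the doubled element of `M`; this
  -- is why a contraction appears on both sides.
  split : BaseCobase (Parallel M) ≈M Parallel (Coloop (BaseCobase M/0))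
  split (false ∷ true  ∷ B) = ⇔-id _
  split (true  ∷ false ∷ B) = ⇔-id _
  split (false ∷ false ∷ B) = mk⇔ proj₂ (λ ())
  split (true  ∷ true  ∷ B) = mk⇔ proj₁ (λ ())

-- Deleting an element

⊆-∣∣≤⇒≡ : {A B : Subset n} → (∀ {z} → A ∋ z → B ∋ z) → ∣ B ∣ ≤ ∣ A ∣ → B ≡ A
⊆-∣∣≤⇒≡ {A = A} {B} A⊆B ∣B∣≤∣A∣ = lookup-ext pointwise
  where
  pointwise : ∀ z → lookup B z ≡ lookup A z
  pointwise z with lookup A z in eqA | lookup B z in eqB
  ... | true  | true  = refl
  ... | false | false = refl
  ... | true  | false = sym (trans (sym (A⊆B eqA)) eqB)
  ... | false | true  = contradiction ∣B∣≤∣A∣ (<⇒≱ (p⊂q⇒∣p∣<∣q∣ {p = A} {q = B}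
          ((λ x∈A → lookup⇒[]= _ B (A⊆B ([]=⇒lookup x∈A))) , z , lookup⇒[]= z B eqB , ∌⇒∉ eqA)))

insertAt-update-here : ∀ (B : Subset n) e a b → insertAt B e a [ e ]≔ b ≡ insertAt B e b
insertAt-update-here B       zero    a b = refl
insertAt-update-here (c ∷ B) (suc e) a b = cong (c ∷_) (insertAt-update-here B e a b)

insertAt-update-punchIn : ∀ (B : Subset n) e a j b →
                          insertAt B e a [ punchIn e j ]≔ b ≡ insertAt (B [ j ]≔ b) e a
insertAt-update-punchIn B       zero    a j       b = refl
insertAt-update-punchIn (c ∷ B) (suc e) a zero    b = refl
insertAt-update-punchIn (c ∷ B) (suc e) a (suc j) b = cong (c ∷_) (insertAt-update-punchIn B e a j b)

avoiding : ∀ (B : Subset (suc n)) {e} → B ∌ e → insertAt (removeAt B e) e false ≡ B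
avoiding B {e} B∌e = trans (cong (insertAt (removeAt B e) e) (sym B∌e)) (insertAt-removeAt B e)

Exchange-≈ : {M M′ : BaseFamily n} → M′ ≈M M → Exchange M → Exchange M′
Exchange-≈ eq ex {A} {B} MA MB A∋x B∌x with ex (to (eq A) MA) (to (eq B) MB) A∋x B∌x
... | y , B∋y , A∌y , MA′ = y , B∋y , A∌y , from (eq _) MA′

deletion-Exchange : ∀ {N : BaseFamily (suc n)} e → Exchange N → Exchange (Minor e false N)
deletion-Exchange {N = N} e ex {A} {B} NA NB {x} A∋x B∌x
  with ex NA NB {punchIn e x} (trans (insertAt-punchIn A e false x) A∋x)
         (trans (insertAt-punchIn B e false x) B∌x)
... | y , B∋y , A∌y , NA′ with e ≟ y
...   | yes refl = ⊥-elim (true≢false B∋y (insertAt-lookup B e false))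
...   | no e≢y with punchOut e≢y | punchIn-punchOut e≢y
...     | j | refl =
  j , trans (sym (insertAt-punchIn B e false j)) B∋y , trans (sym (insertAt-punchIn A e false j)) A∌y ,
  subst N (trans (cong (_[ punchIn e j ]≔ true) (insertAt-update-punchIn A e false x false))
                 (insertAt-update-punchIn (A [ x ]≔ false) e false j true)) NA′

-- Parallel pairs

record IsParallel (N : BaseFamily n) (e f : Fin n) : Set where
  field
    distinct  : e ≢ f
    exclusive : ∀ {B} → N B → B ∋ e → B ∌ f
    nonloopˡ  : ∃[ B ] (N B × B ∋ e)
    nonloopʳ  : ∃[ B ] (N B × B ∋ f)

IsParallel-sym : ∀ {N : BaseFamily n} {e f} → IsParallel N e f → IsParallel N f e
IsParallel-sym p = record
  { distinct = distinct ∘ sym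
  ; exclusive = λ NB B∋f → ¬-not (λ B∋e → true≢false B∋f (exclusive NB B∋e))
  ; nonloopˡ = nonloopʳ
  ; nonloopʳ = nonloopˡ
  }
  where open IsParallel p

-- Bringing `f` into `B` by `coexchange` has to push out `e`, since no base contains both.
parallel-replace : ∀ {N : BaseFamily n} {e f} → Exchange N → IsParallel N e f →
                   ∀ {B} → N B → B ∋ e → N (B ⟨ e ↦ f ⟩)
parallel-replace {N = N} {e} {f} ex p {B} NB B∋e with IsParallel.nonloopʳ p
... | D , ND , D∋f with coexchange {M = N} ex NB ND (IsParallel.exclusive p NB B∋e) D∋f
...   | y , B∋y , D∌y , NB′ with e ≟ y
...     | yes refl = NB′
...     | no e≢y = ⊥-elim (true≢false (lookup∘update f (B [ y ]≔ false) true)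
                     (IsParallel.exclusive p NB′ (↦-∋ B B∋e e≢y)))

nonloop-deletion : ∀ {N : BaseFamily (suc n)} {e f} → IsParallel N e f → ∃ (Minor e false N)
nonloop-deletion {N = N} {e} p with IsParallel.nonloopʳ p
... | B , NB , B∋f =
  removeAt B e , subst N (sym (avoiding B (IsParallel.exclusive (IsParallel-sym p) NB B∋f))) NB

-- An independent set avoiding `e` lies in a base avoiding `e`, because `f` can stand in for `e`.
-- The largest such sets are therefore bases, and conversely all bases have the same size.
delete-parallel : ∀ {N : BaseFamily (suc n)} {e f} → Exchange N → IsParallel N e f →
                  delete N e ≈M Minor e false N
delete-parallel {n} {N} {e} {f} ex p B = mk⇔ isMinor isDelete
  where
  open IsParallel p

  maximal : (∀ I → Independent N (embed e I) → ∣ I ∣ ≤ ∣ B ∣) →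
            ∀ D → N D → D ∌ e → (∀ {z} → embed e B ∋ z → D ∋ z) → N (embed e B)
  maximal max D ND D∌e B⊆D = subst (N ∘ embed e)
      (⊆-∣∣≤⇒≡ {A = B} {removeAt D e}
        (λ {z} B∋z → trans (sym (insertAt-punchIn (removeAt D e) e false z))
          (trans (cong (λ C → lookup C (punchIn e z)) (avoiding D D∌e))
            (B⊆D (trans (insertAt-punchIn B e false z) B∋z))))
        (max (removeAt D e) (D , ND , λ {z} → subst (z ∈_) (avoiding D D∌e))))
      (subst N (sym (avoiding D D∌e)) ND)

  isMinor : delete N e B → N (embed e B)
  isMinor ((D , ND , B⊆D) , max) with lookup D e in D∋e?
  ... | false = maximal max D ND D∋e? (λ B∋z → []=⇒lookup (B⊆D (lookup⇒[]= _ (embed e B) B∋z)))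
  ... | true  = maximal max (D ⟨ e ↦ f ⟩) (parallel-replace ex p ND D∋e?)
      (¬-not λ D′∋e → case ↦-∋⁻ D D′∋e of λ where
        (inj₁ e≡f) → distinct e≡f
        (inj₂ (e≢e , _)) → e≢e refl)
      (λ {z} B∋z → ↦-∋ D ([]=⇒lookup (B⊆D (lookup⇒[]= z (embed e B) B∋z)))
        (∋-≢ (embed e B) B∋z (insertAt-lookup B e false)))

  isDelete : N (embed e B) → delete N e B
  isDelete NB = (embed e B , NB , id) , λ where
    I (D , ND , I⊆D) → ≤-trans (≤-reflexive (sym (∣insertAt∣ I e false)))
      (≤-trans (p⊆q⇒∣p∣≤∣q∣ {p = embed e I} {q = D} I⊆D)
      (≤-trans (∣bases∣-≤ {M = N} ex NB ND) (≤-reflexive (∣insertAt∣ B e false))))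

-- The three `Front`s place `e` at position zero and its partner at position one, as `Parallel`
-- expects; bases through `e` are matched with bases through the partner by `parallel-replace`.
parallel-normal-form : ∀ {N : BaseFamily (suc (suc n))} {e f} →
  Exchange N → IsParallel N e (punchIn e f) →
  Front (suc zero) (Front (suc f) (Front e N)) ≈M Parallel (Front f (Minor e false N))
parallel-normal-form ex p (false ∷ b ∷ B) = ⇔-id _
parallel-normal-form {N = N} {e} {f} ex p (true ∷ true ∷ B) = mk⇔
  (λ NB → true≢false
    (trans (insertAt-punchIn (insertAt B f true) e true f) (insertAt-lookup B f true))
    (IsParallel.exclusive p NB (insertAt-lookup (insertAt B f true) e true)))
  (λ ())
parallel-normal-form {N = N} {e} {f} ex p (true ∷ false ∷ B) = mk⇔
  (λ NB → subst N swap (parallel-replace {N = N} ex p NB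
    (insertAt-lookup (insertAt B f false) e true)))
  (λ NB → subst N swap⁻ (parallel-replace {N = N} ex (IsParallel-sym p) NB
    (trans (insertAt-punchIn (insertAt B f true) e false f) (insertAt-lookup B f true))))
  where
  swap : insertAt (insertAt B f false) e true ⟨ e ↦ punchIn e f ⟩ ≡
         insertAt (insertAt B f true) e false
  swap = trans (cong (_[ punchIn e f ]≔ true) (insertAt-update-here (insertAt B f false) e true false))
    (trans (insertAt-update-punchIn (insertAt B f false) e false f true)
      (cong (λ C → insertAt C e false) (insertAt-update-here B f false true)))
  swap⁻ : insertAt (insertAt B f true) e false ⟨ punchIn e f ↦ e ⟩ ≡
          insertAt (insertAt B f false) e true
  swap⁻ = trans (cong (_[ e ]≔ true) (insertAt-update-punchIn (insertAt B f true) e false f false))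
    (trans (cong (λ C → insertAt C e false [ e ]≔ true) (insertAt-update-here B f true false))
      (insertAt-update-here (insertAt B f false) e false true))

-- From spex(LPM) to the inductive description

empty : (C : Subset n) → ∣ C ∣ ≡ 0 → ∀ z → C ∌ z
empty (false ∷ C) eq zero    = refl
empty (false ∷ C) eq (suc z) = empty C eq z

singleton : (C : Subset n) → ∣ C ∣ ≡ 1 → ∃[ f ] (C ∋ f × ∀ {z} → C ∋ z → z ≡ f)
singleton (true ∷ C) eq = zero , refl , λ
  { {zero}  _   → refl
  ; {suc z} C∋z → ⊥-elim (true≢false C∋z (empty C (suc-injective eq) z)) }
singleton (false ∷ C) eq with singleton C eq
... | f , C∋f , unique = suc f , C∋f , λ { {suc z} C∋z → cong suc (unique C∋z) }

pair : (C : Subset n) → ∣ C ∣ ≡ 2 → ∀ {e} → C ∋ e →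
       ∃[ f ] (e ≢ f × C ∋ f × ∀ {z} → C ∋ z → z ≡ e ⊎ z ≡ f)
pair (true ∷ C) eq {zero} C∋e with singleton C (suc-injective eq)
... | f , C∋f , unique = suc f , (λ ()) , C∋f , λ
  { {zero}  _   → inj₁ refl
  ; {suc z} C∋z → inj₂ (cong suc (unique C∋z)) }
pair (true ∷ C) eq {suc e} C∋e with singleton C (suc-injective eq)
... | f , C∋f , unique = zero , (λ ()) , refl , λ
  { {zero}  _   → inj₂ refl
  ; {suc z} C∋z → inj₁ (cong suc (trans (unique C∋z) (sym (unique C∋e)))) }
pair (false ∷ C) eq {suc e} C∋e with pair C eq C∋e
... | f , e≢f , C∋f , cover = suc f , e≢f ∘ Fin-suc-injective , C∋f , λ
  { {suc z} C∋z → Sum.map (cong suc) (cong suc) (cover C∋z) }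

circuit⇒IsParallel : ∀ {N : BaseFamily n} {C e} → Circuit N C → ∣ C ∣ ≡ 2 → e ∈ C →
                     ∃[ f ] IsParallel N e f
circuit⇒IsParallel {N = N} {C} {e} (dependent , minimal) ∣C∣ e∈C with pair C ∣C∣ ([]=⇒lookup e∈C)
... | f , e≢f , C∋f , cover = f , record
  { distinct  = e≢f
  ; exclusive = λ {B} NB B∋e → ¬-not λ B∋f → dependent (B , NB , λ z∈C → lookup⇒[]= _ B
      (case cover ([]=⇒lookup z∈C) of λ { (inj₁ refl) → B∋e ; (inj₂ refl) → B∋f }))
  ; nonloopˡ  = nonloop e f e≢f e∈C (lookup⇒[]= f C C∋f)
  ; nonloopʳ  = nonloop f e (e≢f ∘ sym) (lookup⇒[]= f C C∋f) e∈C
  }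
  where
  nonloop : ∀ x y → x ≢ y → x ∈ C → y ∈ C → ∃[ B ] (N B × B ∋ x)
  -- A singleton is a proper subset of the two-element circuit, hence independent by minimality.
  nonloop x y x≢y x∈C y∈C with minimal ⁅ x ⁆
    ((λ z∈ → subst (_∈ C) (sym (x∈⁅y⁆⇒x≡y x z∈)) x∈C) ,
     y , y∈C , λ y∈ → x≢y (sym (x∈⁅y⁆⇒x≡y x y∈)))
  ... | B , NB , x⊆B = B , NB , []=⇒lookup (x⊆B (x∈⁅x⁆ x))

-- One step of the induction on `Spex`: a base and the exchange property for the smaller family come
-- down from `N`, and the `Sp` derivation goes back up.
record Reduces (M : BaseFamily n) {m} (N : BaseFamily m) : Set₁ where
  field
    inhabited : ∃ M
    exchange  : Exchange M
    lift      : Sp M → Sp N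

parallel-reduces : {M : BaseFamily n} {N : BaseFamily (suc n)} →
                   Exchange N → ParallelExt N M → Reduces M N
parallel-reduces {n} {M} {N} ex (e , (C , circuit , ∣C∣ , e∈C) , M≈)
  with circuit⇒IsParallel {N = N} circuit ∣C∣ e∈C
... | f , p with punchOut (IsParallel.distinct p) | punchIn-punchOut (IsParallel.distinct p)
parallel-reduces {suc n} {M} {N} ex (e , _ , M≈) | f , p | j | refl = record
  { inhabited = case nonloop-deletion p of λ { (B , NB) → B , to (deleted B) NB }
  ; exchange  = Exchange-≈ (⇔-sym ∘ deleted) (deletion-Exchange {N = N} e ex)
  ; lift      = λ s → Sp-Front⁻ e (Sp-Front⁻ (suc j) (Sp-Front⁻ (suc zero)
      (Sp-≈ (parallel-normal-form {N = N} ex p) (Sp-Parallel (Sp-Front j (Sp-≈ deleted s))))))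
  }
  where
  deleted : Minor e false N ≈M M
  deleted B = M≈ B ⇔-∘ ⇔-sym (delete-parallel {N = N} ex p B)

-- Cocircuits and `contract` are defined through the dual, so `dual N` is a parallel extension of
-- `dual M`.
series-reduces : {M : BaseFamily n} {N : BaseFamily (suc n)} →
                 Exchange N → SeriesExt N M → Reduces M N
series-reduces {M = M} {N} ex (e , cocircuit , M≈) = record
  { inhabited = case inhabited of λ { (B , MB) → ∁ B , MB }
  ; exchange  = Exchange-≈ (λ B → ≡⇒⇔ M (sym (∁-involutive B))) (dual-Exchange {M = dual M} exchange)
  ; lift      = Sp-undual ∘ lift ∘ dualise
  }
  where
  open Reduces (parallel-reduces {M = dual M} (dual-Exchange {M = N} ex)
    (e , cocircuit , λ B → M≈ (∁ B) ⇔-∘ ≡⇒⇔ (delete (dual N) e) (sym (∁-involutive B))))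

bijection⇒permutation : ∀ {m n} {f : Fin m → Fin n} → Bijective _≡_ _≡_ f → Permutation m n
bijection⇒permutation bij = ⤖⇒↔ (mk⤖ bij)

Spex⇒Sp : {M : BaseFamily n} → Spex M → ∃ M → Exchange M → Sp M
Spex⇒Sp {M = M} (lpm (r , U , L , ∣U∣ , ∣L∣ , L≤U , f , bij , iff)) inh ex =
  relabel (flip π) (Relabels-flip π {M} iff)
    (interval (Interval-LPM ∣U∣ ∣L∣) (L , ∣L∣ , L≤U , λ i → ≤-refl))
  where π = bijection⇒permutation bij
Spex⇒Sp (par {M' = M} {N} s ext) inh ex = lift (Spex⇒Sp s inhabited exchange)
  where open Reduces (parallel-reduces {M = M} {N} ex ext)
Spex⇒Sp (ser {M' = M} {N} s ext) inh ex = lift (Spex⇒Sp s inhabited exchange)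
  where open Reduces (series-reduces {M = M} {N} ex ext)
-- `relabel` keeps the size fixed; the bijection forces the two sizes to agree.
Spex⇒Sp (iso {M = M} {M′} s (f , bij , iff)) (B , MB) ex with ↔⇒≡ (bijection⇒permutation bij)
... | refl = relabel π iff
    (Spex⇒Sp s (π ◃ B , to (iff B) MB)
      (Relabels-Exchange (flip π) {M′} {M} (Relabels-flip π {M} iff) ex))
  where π = bijection⇒permutation bij

-- From the inductive description to spex(LPM)

-- `N` is given only up to `≈M` because the series case applies this to `dual (dual (Parallel M))`.
Parallel-ext : {M : BaseFamily (suc n)} {N : BaseFamily (suc (suc n))} →
               Exchange M → ∃ (Minor zero true M) → N ≈M Parallel M → ParallelExt N M
Parallel-ext {n} {M} {N} ex (B , MB) N≈ =
  zero , (C , (dependent , minimal) , cong (λ k → suc (suc k)) (∣⊥∣≡0 n) , here) ,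
  λ { A@(_ ∷ _) → N≈ (false ∷ A) ⇔-∘ delete-parallel {N = N} exN p A }
  where
  C : Subset (suc (suc n))
  C = true ∷ true ∷ ∅

  exN : Exchange N
  exN = Exchange-≈ {M = Parallel M} N≈ λ {A} {B} → Parallel-Exchange {M = M} ex {A} {B}

  first second : Subset (suc (suc n))
  first  = true ∷ false ∷ B
  second = false ∷ true ∷ B

  exclusive : ∀ {A} → N A → A ∋ zero → A ∌ suc zero
  exclusive {true ∷ true  ∷ A} NA _ = ⊥-elim (to (N≈ _) NA)
  exclusive {true ∷ false ∷ A} NA _ = refl

  p : IsParallel N zero (suc zero)
  p = record
    { distinct  = λ ()
    ; exclusive = exclusive
    ; nonloopˡ  = first , from (N≈ first) MB , refl
    ; nonloopʳ  = second , from (N≈ second) MB , refl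
    }

  dependent : ¬ Independent N C
  dependent (A , NA , C⊆A) =
    true≢false ([]=⇒lookup (C⊆A (there here))) (exclusive NA ([]=⇒lookup (C⊆A here)))

  minimal : ∀ D → D ⊂ C → Independent N D
  minimal (d₀ ∷ false ∷ D) (D⊆C , _) = first , from (N≈ first) MB , λ where
    here → here
    (there (there z∈D)) → contradiction (drop-there (drop-there (D⊆C (there (there z∈D))))) ∉⊥
  minimal (false ∷ true ∷ D) (D⊆C , _) = second , from (N≈ second) MB , λ where
    (there here) → there here
    (there (there z∈D)) → contradiction (drop-there (drop-there (D⊆C (there (there z∈D))))) ∉⊥
  minimal (true ∷ true ∷ D) (D⊆C , zero , _ , z∉D) = contradiction here z∉D
  minimal (true ∷ true ∷ D) (D⊆C , suc zero , _ , z∉D) = contradiction (there here) z∉D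
  minimal (true ∷ true ∷ D) (D⊆C , suc (suc z) , there (there z∈⊥) , _) = contradiction z∈⊥ ∉⊥

relabelled : ∀ (π : Permutation n n) (M M′ : BaseFamily n) → Relabels π M M′ → M ≅M M′
relabelled π M M′ rel = (π ⟨$⟩ʳ_) , Bijection.bijective (↔⇒⤖ π) , rel

-- `Spex` has no constructor for duality, so a dual is pushed down the derivation, turning parallel
-- extensions into series extensions until it reaches an interval family.
Sp⇒Spex      : {M : BaseFamily n} → Sp M → Spex M
Sp⇒Spex-dual : {M : BaseFamily n} → Sp M → Spex (dual M)

Sp⇒Spex (interval I inh)     = lpm (Interval⇒IsLPM I inh)
Sp⇒Spex (parallel s nonloop) =
  par (Sp⇒Spex s) (Parallel-ext (Sp-Exchange s) nonloop (λ _ → ⇔-id _))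
Sp⇒Spex (dualise s)          = Sp⇒Spex-dual s
Sp⇒Spex (relabel {M = M} {M′} π rel s) = iso (Sp⇒Spex s) (relabelled π M M′ rel)

Sp⇒Spex-dual (interval I inh) =
  lpm (Interval⇒IsLPM (Interval-dual I) (Sp-inhabited (dualise (interval I inh))))
Sp⇒Spex-dual (parallel {M = M} s nonloop)
  with Parallel-ext {N = dual (dual (Parallel M))} (Sp-Exchange s) nonloop
         (λ B → ≡⇒⇔ (Parallel M) (∁-involutive B))
... | e , circuit , M≈ = ser (Sp⇒Spex-dual s) (e , circuit , λ B → M≈ (∁ B))
Sp⇒Spex-dual (dualise {M = M} s) = iso (Sp⇒Spex s)
  (relabelled idₚ M (dual (dual M)) λ B → ≡⇒⇔ M (trans (∁-involutive B) (sym (tabulate∘lookup B))))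
Sp⇒Spex-dual (relabel {M = M} {M′} π rel s) =
  iso (Sp⇒Spex-dual s) (relabelled π (dual M) (dual M′) (Relabels-dual π {M} {M′} rel))

theorem3p6 : ∀ {n : ℕ} (M : BaseFamily n) → IsMatroid M → Spex M → IsBlock M →
    Σ (BaseFamily n) (λ N → IsMatroid N × Spex N × (N ≈M BaseCobase M))
theorem3p6 {n} M isM spex block =
  BaseCobase M , Exchange⇒IsMatroid block (Sp-Exchange s) , Sp⇒Spex s , λ _ → ⇔-id _
  where
  s : Sp (BaseCobase M)
  s = Sp-BaseCobase n (Spex⇒Sp spex (IsMatroid.base-exists isM) (IsMatroid⇒Exchange isM)) block
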